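{- For all integers $n \geq 5$ and $k \geq 1$ with $n \geq 2k$, there exists a Latin square $L=[L_{ij}]$ of order $n$ (rows, columns and symbols indexed by $\{0,\dots,n-1\}$) such that $L_{ii}=i$ for all $i \in \{0,\ldots,n-k-1\}$ and the $k\times k$ submatrix formed by the rows and columns indexed by $\{n-k,\ldots,n-1\}$ is a Latin square on the symbols $\{0,\ldots,k-1\}$. Consequently, $L$ has a maximal partial transversal of size $n-k$.
   Context: A Latin square of order $n$ is an $n\times n$ array on $n$ symbols in which each symbol occurs once in each row and each column; its entries are the triples $(i,j,L_{ij})$. A line is the set of all entries in a given row, in a given column, or with a given symbol. A partial transversal is a set of entries in which every line is represented at most once; it is maximal if it is not contained in any larger partial transversal. -}

module Defs where

open import Data.Nat using (ℕ; _+_; _∸_; _≤_; _<_)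
open import Data.Nat.Properties using (+-monoʳ-<; m∸n+n≡m; +-comm)
open import Data.Fin using (Fin; toℕ; fromℕ<)
open import Data.Fin.Properties using (toℕ<n)
open import Data.Product using (Σ; _×_; _,_; proj₁)
open import Data.List using (List; length)
open import Data.List.Membership.Propositional using (_∈_)
open import Data.List.Relation.Unary.AllPairs using (AllPairs)
open import Relation.Binary.PropositionalEquality using (_≡_; _≢_; subst; trans; sym)

Square : ℕ → Set
Square n = Fin n → Fin n → Fin n

IsLatin : ∀ {n} → Square n → Set
IsLatin {n} L =
  ((i s : Fin n) → Σ (Fin n) λ j → L i j ≡ s × ((j' : Fin n) → L i j' ≡ s → j' ≡ j)) ×
  ((j s : Fin n) → Σ (Fin n) λ i → L i j ≡ s × ((i' : Fin n) → L i' j ≡ s → i' ≡ i))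

-- An entry (i , j , L i j) is determined by its cell (i , j).
Cell : ℕ → Set
Cell n = Fin n × Fin n

row col : ∀ {n} → Cell n → Fin n
row (i , _) = i
col (_ , j) = j

sym' : ∀ {n} → Square n → Cell n → Fin n
sym' L (i , j) = L i j

Disjoint : ∀ {n} → Square n → Cell n → Cell n → Set
Disjoint L c d = row c ≢ row d × col c ≢ col d × sym' L c ≢ sym' L d

-- A partial transversal, given as a list of its entries; every line is
-- represented at most once (any two listed entries share no line; in
-- particular no entry is listed twice, so the size is the list length).
IsPartialTransversal : ∀ {n} → Square n → List (Cell n) → Set
IsPartialTransversal L T = AllPairs (Disjoint L) T

_⊆_ : ∀ {n} → List (Cell n) → List (Cell n) → Set
T ⊆ T' = ∀ {c} → c ∈ T → c ∈ T'

IsMaximalPartialTransversal : ∀ {n} → Square n → List (Cell n) → Set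
IsMaximalPartialTransversal L T =
  IsPartialTransversal L T ×
  ((T' : List (Cell _)) → IsPartialTransversal L T' → T ⊆ T' → T' ⊆ T)

lastBlock : ∀ {n k} → k ≤ n → Fin k → Fin n
lastBlock {n} {k} k≤n a =
  fromℕ< {n ∸ k + toℕ a}
    (subst (n ∸ k + toℕ a <_) (m∸n+n≡m k≤n) (+-monoʳ-< (n ∸ k) (toℕ<n a)))

{-# OPTIONS --safe #-}

-- Write m = n ∸ k ≥ k. The rows, columns and symbols split into m positions
-- and k further lines. The k × k corner carries the symbols 0 … k-1
-- ("constants"), so in the m × m block each constant occupies a full
-- permutation, and the other cells carry the old symbols k … m-1 and the new
-- symbols m … n-1; a symbol displaced from the block reappears in the borders.
-- * m odd: start from the idempotent square s = (i + j)/2 on ℤ/m, and on the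
--   diagonal s - i = e + 1 (e < k) replace every non-constant symbol by the
--   new symbol e. The borders list s = i + e + 1 and s = j - e - 1, where each
--   constant has to be renamed to a new symbol; k-1-s and s do it.
-- * m even: adjoin a point ∞ to the square (i + j)/2 on ℤ/(m-1) by prolongation
--   along one diagonal. For k ≤ m-3 the odd construction adapts, with ∞ as a
--   constant. For k = m-1 every off-diagonal ∞ gives way to a new symbol, and
--   for k = m nothing has to be displaced.
-- * m even, k = m-2: in ℤ/m the cell (x , y) depends on d = y - x; each
--   d ∉ {0 , m/2} is one constant. A zigzag through ℤ/m gives a transversal
--   with all these differences, and its cells become the main diagonal.
-- The diagonal cells 0 … m-1 form a partial transversal; a cell extending it
-- would lie in the corner and so repeat a constant.
module Submission where

open import Defs
open import Data.Nat using (ℕ; _∸_; _≤_; _<_)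
open import Data.Nat.Properties using (≤-trans; m≤n*m)
open import Data.Fin using (Fin; toℕ)
open import Data.Product using (Σ; _×_)
open import Data.List using (List; length)
open import Relation.Binary.PropositionalEquality using (_≡_)

open import Algebra.Solver.Ring.AlmostCommutativeRing using (AlmostCommutativeRing; _-Raw-AlmostCommutative⟶_)
import Algebra.Solver.Ring as RingSolver
open import Data.Bool using (if_then_else_)
open import Data.Empty using (⊥-elim)
open import Data.Fin using (zero; suc; fromℕ; fromℕ<; inject₁; inject≤; join; opposite; punchIn; punchOut; splitAt; _↑ˡ_; _↑ʳ_)
open import Data.Fin.Properties using (_≟_; injective⇒≤; join-splitAt; opposite-involutive; opposite-prop; punchIn-injective; punchIn-punchOut; punchInᵢ≢i; splitAt-↑ˡ; splitAt-↑ʳ; splitAt⁻¹-↑ˡ; splitAt⁻¹-↑ʳ; toℕ-fromℕ; toℕ-fromℕ<; toℕ-inject₁; toℕ-inject≤; toℕ-injective; toℕ-↑ˡ; toℕ-↑ʳ; toℕ<n; ↑ˡ-injective)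
open import Data.Integer as ℤ using (ℤ; 0ℤ; 1ℤ)
open import Data.Integer.DivMod using (a≡a%ℕn+[a/ℕn]*n; n%ℕd<d)
import Data.Integer.Properties as ℤₚ
open import Data.Integer.Solver using () renaming (module +-*-Solver to ℤ-Solver)
open import Data.List using (tabulate)
open import Data.List.Membership.Propositional using (_∈_)
open import Data.List.Membership.Propositional.Properties using (∈-tabulate⁺)
open import Data.List.Properties using (length-tabulate)
import Data.List.Relation.Unary.All as All
open import Data.List.Relation.Unary.AllPairs using (_∷_)
import Data.List.Relation.Unary.AllPairs.Properties as AllPairs
open import Data.List.Relation.Unary.Any using (here; there)
open import Data.Maybe using (Maybe; just; maybe; nothing)
open import Data.Nat as ℕ using (NonZero; s≤s; z≤n)
import Data.Nat.Properties as ℕₚ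
open import Data.Product using (_,_; proj₁; proj₂; ∃)
open import Data.Sum as Sum using (_⊎_; inj₁; inj₂)
open import Function using (id; _∘_)
open import Relation.Binary.Definitions using (tri<; tri≈; tri>)
open import Relation.Binary.PropositionalEquality using (_≢_; cong; cong₂; isEquivalence; module ≡-Reasoning; refl; subst; sym; trans)
open import Relation.Nullary using (does; no; yes; ¬_)
open import Relation.Nullary.Decidable using (dec-false; dec-true)

-- Arithmetic modulo q

-- The constructions see ℤ/q only through this interface: `[_]` is a homomorphism from ℤ sending q
-- to 0, and `toℕ` is a section of it. Ring laws are inherited from ℤ, and the division algorithm
-- stays hidden.
record Residues (q : ℕ) : Set where
  infixl 6 _+_ _-_
  infixl 7 _*_
  field
    _+_ _*_ : Fin q → Fin q → Fin q
    neg : Fin q → Fin q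
    [_] : ℤ → Fin q
    []-toℕ : ∀ x → [ ℤ.+ toℕ x ] ≡ x
    []-+ : ∀ a b → [ a ℤ.+ b ] ≡ [ a ] + [ b ]
    []-* : ∀ a b → [ a ℤ.* b ] ≡ [ a ] * [ b ]
    []-neg : ∀ a → [ ℤ.- a ] ≡ neg [ a ]
    []-q : [ ℤ.+ q ] ≡ [ 0ℤ ]

  _-_ : Fin q → Fin q → Fin q
  x - y = x + neg y

  private
    ⌊_⌋ : Fin q → ℤ
    ⌊ x ⌋ = ℤ.+ toℕ x

    -- Every residue x is `[ ⌊ x ⌋ ]`, so an identity of ℤ descends as soon as both sides commute
    -- with reduction.
    lift₁ : (F G : ℤ → ℤ) {f g : Fin q → Fin q} →
      (∀ a → [ F a ] ≡ f [ a ]) → (∀ a → [ G a ] ≡ g [ a ]) →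
      (∀ a → F a ≡ G a) → ∀ x → f x ≡ g x
    lift₁ F G {f} {g} f≡ g≡ eq x = subst (λ x → f x ≡ g x) ([]-toℕ x)
      (trans (sym (f≡ ⌊ x ⌋)) (trans (cong [_] (eq ⌊ x ⌋)) (g≡ ⌊ x ⌋)))

    lift₂ : (F G : ℤ → ℤ → ℤ) {f g : Fin q → Fin q → Fin q} →
      (∀ a b → [ F a b ] ≡ f [ a ] [ b ]) → (∀ a b → [ G a b ] ≡ g [ a ] [ b ]) →
      (∀ a b → F a b ≡ G a b) → ∀ x y → f x y ≡ g x y
    lift₂ F G {f} {g} f≡ g≡ eq x y = lift₁ (F ⌊ x ⌋) (G ⌊ x ⌋)
      (λ b → trans (f≡ ⌊ x ⌋ b) (cong (λ x → f x [ b ]) ([]-toℕ x)))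
      (λ b → trans (g≡ ⌊ x ⌋ b) (cong (λ x → g x [ b ]) ([]-toℕ x))) (eq ⌊ x ⌋) y

    lift₃ : (F G : ℤ → ℤ → ℤ → ℤ) {f g : Fin q → Fin q → Fin q → Fin q} →
      (∀ a b c → [ F a b c ] ≡ f [ a ] [ b ] [ c ]) → (∀ a b c → [ G a b c ] ≡ g [ a ] [ b ] [ c ]) →
      (∀ a b c → F a b c ≡ G a b c) → ∀ x y z → f x y z ≡ g x y z
    lift₃ F G {f} {g} f≡ g≡ eq x = lift₂ (F ⌊ x ⌋) (G ⌊ x ⌋)
      (λ b c → trans (f≡ ⌊ x ⌋ b c) (cong (λ x → f x [ b ] [ c ]) ([]-toℕ x)))
      (λ b c → trans (g≡ ⌊ x ⌋ b c) (cong (λ x → g x [ b ] [ c ]) ([]-toℕ x))) (eq ⌊ x ⌋)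

  ring : AlmostCommutativeRing _ _
  ring = record
    { Carrier = Fin q
    ; _≈_ = _≡_
    ; _+_ = _+_
    ; _*_ = _*_
    ; -_ = neg
    ; 0# = [ 0ℤ ]
    ; 1# = [ 1ℤ ]
    ; isAlmostCommutativeRing = record
      { isCommutativeSemiring = record
        { isSemiring = record
          { isSemiringWithoutAnnihilatingZero = record
            { +-isCommutativeMonoid = record
              { isMonoid = record
                { isSemigroup = record
                  { isMagma = record { isEquivalence = isEquivalence ; ∙-cong = cong₂ _+_ }
                  ; assoc = lift₃ (λ a b c → a ℤ.+ b ℤ.+ c) (λ a b c → a ℤ.+ (b ℤ.+ c))
                      (λ a b c → trans ([]-+ _ c) (cong (_+ [ c ]) ([]-+ a b)))
                      (λ a b c → trans ([]-+ a _) (cong ([ a ] +_) ([]-+ b c)))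
                      ℤₚ.+-assoc
                  }
                ; identity =
                    lift₁ (λ a → 0ℤ ℤ.+ a) (λ a → a) ([]-+ 0ℤ) (λ _ → refl) ℤₚ.+-identityˡ ,
                    lift₁ (λ a → a ℤ.+ 0ℤ) (λ a → a) (λ a → []-+ a 0ℤ) (λ _ → refl) ℤₚ.+-identityʳ
                }
              ; comm = lift₂ ℤ._+_ (λ a b → b ℤ.+ a) []-+ (λ a b → []-+ b a) ℤₚ.+-comm
              }
            ; *-cong = cong₂ _*_
            ; *-assoc = lift₃ (λ a b c → a ℤ.* b ℤ.* c) (λ a b c → a ℤ.* (b ℤ.* c))
                (λ a b c → trans ([]-* _ c) (cong (_* [ c ]) ([]-* a b)))
                (λ a b c → trans ([]-* a _) (cong ([ a ] *_) ([]-* b c)))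
                ℤₚ.*-assoc
            ; *-identity =
                lift₁ (λ a → 1ℤ ℤ.* a) (λ a → a) ([]-* 1ℤ) (λ _ → refl) ℤₚ.*-identityˡ ,
                lift₁ (λ a → a ℤ.* 1ℤ) (λ a → a) (λ a → []-* a 1ℤ) (λ _ → refl) ℤₚ.*-identityʳ
            ; distrib =
                lift₃ (λ a b c → a ℤ.* (b ℤ.+ c)) (λ a b c → a ℤ.* b ℤ.+ a ℤ.* c)
                  (λ a b c → trans ([]-* a _) (cong ([ a ] *_) ([]-+ b c)))
                  (λ a b c → trans ([]-+ (a ℤ.* b) (a ℤ.* c)) (cong₂ _+_ ([]-* a b) ([]-* a c)))
                  ℤₚ.*-distribˡ-+ ,
                lift₃ (λ a b c → (b ℤ.+ c) ℤ.* a) (λ a b c → b ℤ.* a ℤ.+ c ℤ.* a)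
                  (λ a b c → trans ([]-* _ a) (cong (_* [ a ]) ([]-+ b c)))
                  (λ a b c → trans ([]-+ (b ℤ.* a) (c ℤ.* a)) (cong₂ _+_ ([]-* b a) ([]-* c a)))
                  ℤₚ.*-distribʳ-+
            }
          ; zero =
              lift₁ (λ a → 0ℤ ℤ.* a) (λ _ → 0ℤ) ([]-* 0ℤ) (λ _ → refl) ℤₚ.*-zeroˡ ,
              lift₁ (λ a → a ℤ.* 0ℤ) (λ _ → 0ℤ) (λ a → []-* a 0ℤ) (λ _ → refl) ℤₚ.*-zeroʳ
          }
        ; *-comm = lift₂ ℤ._*_ (λ a b → b ℤ.* a) []-* (λ a b → []-* b a) ℤₚ.*-comm
        }
      ; -‿cong = cong neg
      ; -‿*-distribˡ = lift₂ (λ a b → ℤ.- a ℤ.* b) (λ a b → ℤ.- (a ℤ.* b))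
          (λ a b → trans ([]-* (ℤ.- a) b) (cong (_* [ b ]) ([]-neg a)))
          (λ a b → trans ([]-neg _) (cong neg ([]-* a b)))
          (λ a b → sym (ℤₚ.neg-distribˡ-* a b))
      ; -‿+-comm = lift₂ (λ a b → ℤ.- a ℤ.+ ℤ.- b) (λ a b → ℤ.- (a ℤ.+ b))
          (λ a b → trans ([]-+ (ℤ.- a) (ℤ.- b)) (cong₂ _+_ ([]-neg a) ([]-neg b)))
          (λ a b → trans ([]-neg _) (cong neg ([]-+ a b)))
          (λ a b → sym (ℤₚ.neg-distrib-+ a b))
      }
    }

  reduction : ℤ.+-*-rawRing -Raw-AlmostCommutative⟶ ring
  reduction = record
    { ⟦_⟧ = [_]
    ; +-homo = []-+
    ; *-homo = []-*
    ; -‿homo = []-neg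
    ; 0-homo = refl
    ; 1-homo = refl
    }

  coefficient≟ : ∀ a b → Maybe ([ a ] ≡ [ b ])
  coefficient≟ a b with a ℤ.≟ b
  ... | yes a≡b = just (cong [_] a≡b)
  ... | no _ = nothing

  open RingSolver ℤ.+-*-rawRing ring reduction coefficient≟ public
    using (solve; _:=_; _:+_; _:-_; _:*_; :-_; con)

  +-cong-toℕ : ∀ {w x y z : Fin q} → toℕ w ℕ.+ toℕ x ≡ toℕ y ℕ.+ toℕ z → w + x ≡ y + z
  +-cong-toℕ {w} {x} {y} {z} eq = trans (sym (sum w x)) (trans (cong (λ n → [ ℤ.+ n ]) eq) (sum y z))
    where
    sum : ∀ x y → [ ℤ.+ (toℕ x ℕ.+ toℕ y) ] ≡ x + y
    sum x y = trans ([]-+ ⌊ x ⌋ ⌊ y ⌋) (cong₂ _+_ ([]-toℕ x) ([]-toℕ y))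

  toℕ-[] : ∀ {n} → n < q → toℕ [ ℤ.+ n ] ≡ n
  toℕ-[] {n} n<q = trans (cong toℕ (trans (cong (λ n → [ ℤ.+ n ]) (sym (toℕ-fromℕ< n<q))) ([]-toℕ (fromℕ< n<q))))
    (toℕ-fromℕ< n<q)

  []-injective : ∀ {a b} → a < q → b < q → [ ℤ.+ a ] ≡ [ ℤ.+ b ] → a ≡ b
  []-injective a<q b<q eq = trans (sym (toℕ-[] a<q)) (trans (cong toℕ eq) (toℕ-[] b<q))

  neg-[] : ∀ c x → toℕ x ℕ.+ c ≡ q → neg [ ℤ.+ c ] ≡ x
  neg-[] c x eq = trans
    (solve 2 (λ x c → :- c := x :+ :- (x :+ c)) refl x [ ℤ.+ c ])
    (trans (cong (λ y → x + neg y) (trans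
        (cong (_+ [ ℤ.+ c ]) (sym ([]-toℕ x)))
        (trans (sym ([]-+ ⌊ x ⌋ (ℤ.+ c))) (trans (cong (λ n → [ ℤ.+ n ]) eq) []-q))))
      (solve 1 (λ x → x :+ :- con 0ℤ := x) refl x))

  module Halving (h : ℕ) (q≡1+2h : q ≡ ℕ.suc (h ℕ.+ h)) where
    -- `1 + h` is the inverse of 2, since 2 (1 + h) = q + 1.
    half : Fin q → Fin q
    half x = ([ 1ℤ ] + [ ℤ.+ h ]) * x

    half-double : ∀ x → half (x + x) ≡ x
    half-double x = trans
      (solve 2 (λ h x → (con 1ℤ :+ h) :* (x :+ x) := x :+ x :* (con 1ℤ :+ (h :+ h))) refl [ ℤ.+ h ] x)
      (trans (cong (λ y → x + x * y) (begin
          [ 1ℤ ] + ([ ℤ.+ h ] + [ ℤ.+ h ])  ≡⟨ cong ([ 1ℤ ] +_) ([]-+ (ℤ.+ h) (ℤ.+ h)) ⟨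
          [ 1ℤ ] + [ ℤ.+ (h ℕ.+ h) ]        ≡⟨ []-+ 1ℤ (ℤ.+ (h ℕ.+ h)) ⟨
          [ ℤ.+ ℕ.suc (h ℕ.+ h) ]           ≡⟨ cong (λ n → [ ℤ.+ n ]) q≡1+2h ⟨
          [ ℤ.+ q ]                         ≡⟨ []-q ⟩
          [ 0ℤ ]                            ∎))
        (solve 1 (λ x → x :+ x :* con 0ℤ := x) refl x))
      where open ≡-Reasoning

residues : ∀ q .{{_ : NonZero q}} → Residues q
residues q = record
  { _+_ = λ x y → [ ⌊ x ⌋ ℤ.+ ⌊ y ⌋ ]
  ; _*_ = λ x y → [ ⌊ x ⌋ ℤ.* ⌊ y ⌋ ]
  ; neg = λ x → [ ℤ.- ⌊ x ⌋ ]
  ; [_] = [_]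
  ; []-toℕ = λ x → toℕ-injective (unique (toℕ<n [ ⌊ x ⌋ ]) (toℕ<n x) (ℤ.- quotient ⌊ x ⌋) (begin
      ⌊ [ ⌊ x ⌋ ] ⌋                                ≡⟨ moveʳ ⌊ x ⌋ ⟩
      ⌊ x ⌋ ℤ.+ ℤ.- quotient ⌊ x ⌋ ℤ.* ℤ.+ q           ∎))
  ; []-+ = λ a b → congruent (a ℤ.+ b) (⌊ [ a ] ⌋ ℤ.+ ⌊ [ b ] ⌋) (quotient a ℤ.+ quotient b)
      (trans (cong₂ ℤ._+_ (remainder a) (remainder b))
        (solve 5 (λ a b c d q → (a :+ c :* q) :+ (b :+ d :* q) := (a :+ b) :+ (c :+ d) :* q)
          refl ⌊ [ a ] ⌋ ⌊ [ b ] ⌋ (quotient a) (quotient b) (ℤ.+ q)))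
  ; []-* = λ a b → congruent (a ℤ.* b) (⌊ [ a ] ⌋ ℤ.* ⌊ [ b ] ⌋)
      (quotient a ℤ.* b ℤ.+ ⌊ [ a ] ⌋ ℤ.* quotient b)
      (trans (cong (ℤ._* b) (remainder a))
        (trans (cong (λ b′ → (⌊ [ a ] ⌋ ℤ.+ quotient a ℤ.* ℤ.+ q) ℤ.* b′) (remainder b))
        (trans (solve 5 (λ a b c d q → (a :+ c :* q) :* (b :+ d :* q)
              := a :* b :+ (c :* (b :+ d :* q) :+ a :* d) :* q)
          refl ⌊ [ a ] ⌋ ⌊ [ b ] ⌋ (quotient a) (quotient b) (ℤ.+ q))
          (cong (λ b′ → ⌊ [ a ] ⌋ ℤ.* ⌊ [ b ] ⌋ ℤ.+ (quotient a ℤ.* b′ ℤ.+ ⌊ [ a ] ⌋ ℤ.* quotient b) ℤ.* ℤ.+ q)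
            (sym (remainder b))))))
  ; []-neg = λ a → congruent (ℤ.- a) (ℤ.- ⌊ [ a ] ⌋) (ℤ.- quotient a)
      (trans (cong ℤ.-_ (remainder a))
        (solve 3 (λ a c q → :- (a :+ c :* q) := :- a :+ :- c :* q)
          refl ⌊ [ a ] ⌋ (quotient a) (ℤ.+ q)))
  ; []-q = congruent (ℤ.+ q) 0ℤ 1ℤ
      (solve 1 (λ q → q := con 0ℤ :+ con 1ℤ :* q) refl (ℤ.+ q))
  }
  where
  open ≡-Reasoning
  open ℤ-Solver using (solve; _:=_; _:+_; _:*_; :-_; con)

  ⌊_⌋ : Fin q → ℤ
  ⌊ x ⌋ = ℤ.+ toℕ x

  [_] : ℤ → Fin q
  [ a ] = fromℕ< (n%ℕd<d a q)

  quotient : ℤ → ℤ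
  quotient a = a ℤ./ℕ q

  remainder : ∀ a → a ≡ ⌊ [ a ] ⌋ ℤ.+ quotient a ℤ.* ℤ.+ q
  remainder a = trans (a≡a%ℕn+[a/ℕn]*n a q)
    (cong (λ r → ℤ.+ r ℤ.+ quotient a ℤ.* ℤ.+ q) (sym (toℕ-fromℕ< (n%ℕd<d a q))))

  moveʳ : ∀ a → ⌊ [ a ] ⌋ ≡ a ℤ.+ ℤ.- quotient a ℤ.* ℤ.+ q
  moveʳ a = trans (solve 3 (λ r c q → r := (r :+ c :* q) :+ :- c :* q) refl ⌊ [ a ] ⌋ (quotient a) (ℤ.+ q))
    (cong (ℤ._+ ℤ.- quotient a ℤ.* ℤ.+ q) (sym (remainder a)))

  -- A positive multiple of q on the right would force `q ≤ r`.
  unique⁺ : ∀ {r t} c → r < q → ℤ.+ r ≡ ℤ.+ t ℤ.+ ℤ.+ c ℤ.* ℤ.+ q → r ≡ t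
  unique⁺ {r} {t} ℕ.zero _ eq = ℤₚ.+-injective (trans eq (ℤₚ.+-identityʳ (ℤ.+ t)))
  unique⁺ {r} {t} (ℕ.suc c) r<q eq = ⊥-elim (ℕₚ.<⇒≱ r<q (q≤r))
    where
    r≡ : r ≡ t ℕ.+ ℕ.suc c ℕ.* q
    r≡ = ℤₚ.+-injective (trans eq (trans (cong (λ u → ℤ.+ t ℤ.+ u) (sym (ℤₚ.pos-* (ℕ.suc c) q)))
      (sym (ℤₚ.pos-+ t (ℕ.suc c ℕ.* q)))))
    q≤r : q ≤ r
    q≤r = ℕₚ.≤-trans (ℕₚ.m≤m+n q (c ℕ.* q))
      (ℕₚ.≤-trans (ℕₚ.m≤n+m (ℕ.suc c ℕ.* q) t) (ℕₚ.≤-reflexive (sym r≡)))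

  unique : ∀ {r t} → r < q → t < q → ∀ c → ℤ.+ r ≡ ℤ.+ t ℤ.+ c ℤ.* ℤ.+ q → r ≡ t
  unique r<q _ (ℤ.+ c) eq = unique⁺ c r<q eq
  -- With a negative coefficient the two remainders exchange roles.
  unique {r} {t} _ t<q c@(ℤ.-[1+ n ]) eq = sym (unique⁺ (ℕ.suc n) t<q (begin
    ℤ.+ t                                     ≡⟨ solve 3 (λ t c q → t := (t :+ c :* q) :+ :- c :* q) refl (ℤ.+ t) c (ℤ.+ q) ⟩
    (ℤ.+ t ℤ.+ c ℤ.* ℤ.+ q) ℤ.+ ℤ.- c ℤ.* ℤ.+ q   ≡⟨ cong (ℤ._+ ℤ.- c ℤ.* ℤ.+ q) eq ⟨
    ℤ.+ r ℤ.+ ℤ.- c ℤ.* ℤ.+ q                   ∎))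

  congruent : ∀ a b c → a ≡ b ℤ.+ c ℤ.* ℤ.+ q → [ a ] ≡ [ b ]
  congruent a b c eq = toℕ-injective (unique (toℕ<n [ a ]) (toℕ<n [ b ])
    (c ℤ.+ quotient b ℤ.+ ℤ.- quotient a) (begin
      ⌊ [ a ] ⌋                             ≡⟨ moveʳ a ⟩
      a ℤ.+ ℤ.- quotient a ℤ.* ℤ.+ q
        ≡⟨ cong (ℤ._+ ℤ.- quotient a ℤ.* ℤ.+ q) (trans eq (cong (ℤ._+ c ℤ.* ℤ.+ q) (remainder b))) ⟩
      ⌊ [ b ] ⌋ ℤ.+ quotient b ℤ.* ℤ.+ q ℤ.+ c ℤ.* ℤ.+ q ℤ.+ ℤ.- quotient a ℤ.* ℤ.+ q
        ≡⟨ solve 5 (λ r u c v q → r :+ u :* q :+ c :* q :+ :- v :* q := r :+ (c :+ u :+ :- v) :* q)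
             refl ⌊ [ b ] ⌋ (quotient b) c (quotient a) (ℤ.+ q) ⟩
      ⌊ [ b ] ⌋ ℤ.+ (c ℤ.+ quotient b ℤ.+ ℤ.- quotient a) ℤ.* ℤ.+ q ∎))

-- Latin squares from surjective lines

-- If g (f x) ≢ x, then g misses x, so x and the values of g are 1 + n elements
-- of Fin n.
right-inverse⇒left-inverse : ∀ {n} (f g : Fin n → Fin n) → (∀ y → f (g y) ≡ y) → ∀ x → g (f x) ≡ x
right-inverse⇒left-inverse {n} f g f∘g x with g (f x) ≟ x
... | yes eq = eq
... | no x∉g = ⊥-elim (ℕₚ.1+n≰n (injective⇒≤ {f = h} h-injective))
  where
  h : Fin (ℕ.suc n) → Fin n
  h zero = x
  h (suc y) = g y

  missed : ∀ y → g y ≢ x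
  missed y refl = x∉g (cong g (f∘g y))

  h-injective : ∀ {a b} → h a ≡ h b → a ≡ b
  h-injective {zero} {zero} _ = refl
  h-injective {zero} {suc b} eq = ⊥-elim (missed b (sym eq))
  h-injective {suc a} {zero} eq = ⊥-elim (missed a eq)
  h-injective {suc a} {suc b} eq = cong suc (trans (sym (f∘g a)) (trans (cong f eq) (f∘g b)))

-- A surjective self-map of a finite set is bijective, so it is enough to locate every symbol in
-- every line; uniqueness then follows.
surjective-lines⇒IsLatin : ∀ {n} (L : Square n) →
  (∀ i s → ∃ λ j → L i j ≡ s) → (∀ j s → ∃ λ i → L i j ≡ s) → IsLatin L
surjective-lines⇒IsLatin L rows cols = (λ i → bijective (L i) (rows i)) , (λ j → bijective (λ i → L i j) (cols j))
  where
  bijective : ∀ {n} (f : Fin n → Fin n) → (∀ s → ∃ λ j → f j ≡ s) →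
    ∀ s → Σ (Fin n) λ j → f j ≡ s × (∀ j′ → f j′ ≡ s → j′ ≡ j)
  bijective f f-surjective s = proj₁ (f-surjective s) , proj₂ (f-surjective s) , λ { j′ refl →
    sym (right-inverse⇒left-inverse f (λ y → proj₁ (f-surjective y)) (λ y → proj₂ (f-surjective y)) j′) }

-- Maximality of the main diagonal

-- `AllPairs` compares an entry only with later ones; `Disjoint` is symmetric, so the order of c and
-- d is immaterial.
distinct⇒disjoint : ∀ {n} {L : Square n} {T c d} → IsPartialTransversal L T →
  c ∈ T → d ∈ T → c ≡ d ⊎ Disjoint L c d
distinct⇒disjoint _ (here refl) (here refl) = inj₁ refl
distinct⇒disjoint (c# ∷ _) (here refl) (there d∈T) = inj₂ (All.lookup c# d∈T)
distinct⇒disjoint (d# ∷ _) (there c∈T) (here refl) with All.lookup d# c∈T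
... | r≢ , c≢ , s≢ = inj₂ (r≢ ∘ sym , c≢ ∘ sym , s≢ ∘ sym)
distinct⇒disjoint (_ ∷ T#) (there c∈T) (there d∈T) = distinct⇒disjoint T# c∈T d∈T

module _ {m k : ℕ} (L : Square (m ℕ.+ k)) (diagonal : ∀ a → L (a ↑ˡ k) (a ↑ˡ k) ≡ a ↑ˡ k)
  (corner : ∀ a b → ∃ λ c → L (m ↑ʳ a) (m ↑ʳ b) ≡ c ↑ˡ k) where

  private
    diagonalCell : Fin m → Cell (m ℕ.+ k)
    diagonalCell a = a ↑ˡ k , a ↑ˡ k

  diagonalCells : List (Cell (m ℕ.+ k))
  diagonalCells = tabulate diagonalCell

  diagonalCells-transversal : IsPartialTransversal L diagonalCells
  diagonalCells-transversal = AllPairs.tabulate⁺ {f = diagonalCell} λ {a} {b} a≢b →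
    a≢b ∘ ↑ˡ-injective k a b , a≢b ∘ ↑ˡ-injective k a b ,
    λ eq → a≢b (↑ˡ-injective k a b (trans (sym (diagonal a)) (trans eq (diagonal b))))

  diagonalCells-maximal : IsMaximalPartialTransversal L diagonalCells
  diagonalCells-maximal = diagonalCells-transversal , maximal
    where
    -- Both cells lie in `T`, whose distinct entries share no line; a shared line therefore makes
    -- them equal.
    meets : ∀ {T c} → IsPartialTransversal L T → diagonalCells ⊆ T → c ∈ T →
      ∀ a → ¬ Disjoint L c (diagonalCell a) → c ∈ diagonalCells
    meets T# ⊆T c∈T a ¬# with distinct⇒disjoint T# c∈T (⊆T (∈-tabulate⁺ {f = diagonalCell} a))
    ... | inj₁ refl = ∈-tabulate⁺ {f = diagonalCell} a
    ... | inj₂ c# = ⊥-elim (¬# c#)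

    maximal : ∀ T → IsPartialTransversal L T → diagonalCells ⊆ T → T ⊆ diagonalCells
    maximal T T# ⊆T {i , j} c∈T with splitAt m i in i≡ | splitAt m j in j≡
    ... | inj₁ a | _ = meets T# ⊆T c∈T a λ (r≢ , _) → r≢ (sym (splitAt⁻¹-↑ˡ i≡))
    ... | inj₂ _ | inj₁ b = meets T# ⊆T c∈T b λ (_ , c≢ , _) → c≢ (sym (splitAt⁻¹-↑ˡ j≡))
    -- A corner cell avoids the rows and columns of the diagonal, but its symbol c is already used
    -- by diagonal cell c.
    ... | inj₂ a | inj₂ b = meets T# ⊆T c∈T (proj₁ (corner a b)) λ (_ , _ , s≢) → s≢
      (trans (cong₂ L (sym (splitAt⁻¹-↑ʳ i≡)) (sym (splitAt⁻¹-↑ʳ j≡)))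
        (trans (proj₂ (corner a b)) (sym (diagonal (proj₁ (corner a b))))))

-- Blueprints and their realisation as squares on `Fin n`

-- The rows, columns and symbols are Position ⊎ Fin k, where Fin k stands for
-- the last k indices.
record Blueprint (m : ℕ) {k : ℕ} (K : Residues k) : Set₁ where
  field
    Position : Set
    index : Position → Fin m
    position : Fin m → Position
    index-position : ∀ i → index (position i) ≡ i
    position-index : ∀ p → position (index p) ≡ p
    entry : Position ⊎ Fin k → Position ⊎ Fin k → Position ⊎ Fin k
    rows : ∀ x z → ∃ λ y → entry x y ≡ z
    cols : ∀ y z → ∃ λ x → entry x y ≡ z
    diagonal : ∀ p → entry (inj₁ p) (inj₁ p) ≡ inj₁ p
    const : Fin k → Position
    index-const : ∀ a → toℕ (index (const a)) ≡ toℕ a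
    corner : ∀ a b → entry (inj₂ a) (inj₂ b) ≡ inj₁ (const (Residues._+_ K a b))

-- The proof of `k ≤ n` is a parameter so that `n` can be replaced by `m + k` in `realise`.
Conclusion : (n k : ℕ) → k ≤ n → Set
Conclusion n k k≤n = Σ (Square n) λ L →
  IsLatin L ×
  ((i : Fin n) → toℕ i < n ∸ k → L i i ≡ i) ×
  (Σ (Square k) λ S →
    IsLatin S ×
    ((a b : Fin k) → toℕ (L (lastBlock k≤n a) (lastBlock k≤n b)) ≡ toℕ (S a b))) ×
  (Σ (List (Cell n)) λ T → IsMaximalPartialTransversal L T × length T ≡ n ∸ k)

+-isLatin : ∀ {k} (K : Residues k) → IsLatin (Residues._+_ K)
+-isLatin K = surjective-lines⇒IsLatin _+_
  (λ a s → s - a , solve 2 (λ a s → a :+ (s :- a) := s) refl a s)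
  (λ a s → s - a , solve 2 (λ a s → (s :- a) :+ a := s) refl a s)
  where open Residues K

-- One bijection relabels rows, columns and symbols alike, so the condition that position p carries
-- symbol p in its diagonal cell survives the transfer.
realise : ∀ {n m k} {K : Residues k} (k≤n : k ≤ n) → n ≡ m ℕ.+ k → Blueprint m K → Conclusion n k k≤n
realise {m = m} {k} {K} k≤n refl B =
  L , L-latin , (λ i i< → diagonal-below i (subst (toℕ i <_) (ℕₚ.m+n∸n≡m m k) i<)) ,
  (K._+_ , +-isLatin K , L-corner) ,
  diagonalCells L L-diagonal corner-below , diagonalCells-maximal L L-diagonal corner-below ,
  trans (length-tabulate _) (sym (ℕₚ.m+n∸n≡m m k))
  where
  open Blueprint B
  module K = Residues K

  decode : Fin (m ℕ.+ k) → Position ⊎ Fin k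
  decode i = Sum.map₁ position (splitAt m i)

  encode : Position ⊎ Fin k → Fin (m ℕ.+ k)
  encode x = join m k (Sum.map₁ index x)

  decode-encode : ∀ x → decode (encode x) ≡ x
  decode-encode (inj₁ p) rewrite splitAt-↑ˡ m (index p) k = cong inj₁ (position-index p)
  decode-encode (inj₂ e) rewrite splitAt-↑ʳ m k e = refl

  encode-decode : ∀ i → encode (decode i) ≡ i
  encode-decode i = trans (cong (join m k) (map-index-position (splitAt m i))) (join-splitAt m k i)
    where
    map-index-position : (x : Fin m ⊎ Fin k) → Sum.map₁ index (Sum.map₁ position x) ≡ x
    map-index-position (inj₁ a) = cong inj₁ (index-position a)
    map-index-position (inj₂ e) = refl

  L : Square (m ℕ.+ k)
  L i j = encode (entry (decode i) (decode j))

  L-latin : IsLatin L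
  L-latin = surjective-lines⇒IsLatin L
    (λ i s → let y , eq = rows (decode i) (decode s) in encode y ,
      trans (cong encode (trans (cong (entry (decode i)) (decode-encode y)) eq)) (encode-decode s))
    (λ j s → let x , eq = cols (decode j) (decode s) in encode x ,
      trans (cong encode (trans (cong (λ x → entry x (decode j)) (decode-encode x)) eq)) (encode-decode s))

  L-diagonal : ∀ a → L (a ↑ˡ k) (a ↑ˡ k) ≡ a ↑ˡ k
  L-diagonal a rewrite splitAt-↑ˡ m a k | diagonal (position a) = cong (_↑ˡ k) (index-position a)

  L-const : ∀ a b → L (m ↑ʳ a) (m ↑ʳ b) ≡ index (const (a K.+ b)) ↑ˡ k
  L-const a b rewrite splitAt-↑ʳ m k a | splitAt-↑ʳ m k b | corner a b = refl

  corner-below : ∀ a b → ∃ λ c → L (m ↑ʳ a) (m ↑ʳ b) ≡ c ↑ˡ k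
  corner-below a b = index (const (a K.+ b)) , L-const a b

  diagonal-below : ∀ i → toℕ i < m → L i i ≡ i
  diagonal-below i i<m = subst (λ i → L i i ≡ i)
    (toℕ-injective (trans (toℕ-↑ˡ (fromℕ< i<m) k) (toℕ-fromℕ< i<m))) (L-diagonal (fromℕ< i<m))

  lastBlock≡ : ∀ a → lastBlock k≤n a ≡ m ↑ʳ a
  lastBlock≡ a = toℕ-injective (trans (toℕ-fromℕ< _)
    (trans (cong (ℕ._+ toℕ a) (ℕₚ.m+n∸n≡m m k)) (sym (toℕ-↑ʳ m a))))

  L-corner : ∀ a b → toℕ (L (lastBlock k≤n a) (lastBlock k≤n b)) ≡ toℕ (a K.+ b)
  L-corner a b rewrite lastBlock≡ a | lastBlock≡ b | L-const a b =
    trans (toℕ-↑ˡ (index (const (a K.+ b))) k) (index-const (a K.+ b))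

-- m odd

below : ∀ {q} k → Fin q → Maybe (Fin k)
below k x with toℕ x ℕ.<? k
... | yes x<k = just (fromℕ< x<k)
... | no _ = nothing

below-inject≤ : ∀ {q k} (e : Fin k) .(k≤q : k ≤ q) → below k (inject≤ e k≤q) ≡ just e
below-inject≤ {k = k} e k≤q with toℕ (inject≤ e k≤q) ℕ.<? k
... | yes e<k = cong just (toℕ-injective (trans (toℕ-fromℕ< e<k) (toℕ-inject≤ e k≤q)))
... | no e≮k = ⊥-elim (e≮k (subst (_< k) (sym (toℕ-inject≤ e k≤q)) (toℕ<n e)))

below-just : ∀ {q k e} (x : Fin q) .(k≤q : k ≤ q) → below k x ≡ just e → inject≤ e k≤q ≡ x
below-just {k = k} x k≤q eq with toℕ x ℕ.<? k
below-just x k≤q refl | yes x<k = toℕ-injective (trans (toℕ-inject≤ _ k≤q) (toℕ-fromℕ< x<k))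

below-≥ : ∀ {q} k (x : Fin q) → k ≤ toℕ x → below k x ≡ nothing
below-≥ k x k≤x with toℕ x ℕ.<? k
... | yes x<k = ⊥-elim (ℕₚ.<⇒≱ x<k k≤x)
... | no _ = refl

toℕ-opposite : ∀ {k} (e : Fin k) → toℕ e ℕ.+ toℕ (opposite e) ≡ k ∸ 1
toℕ-opposite {ℕ.suc k} e = trans (cong (toℕ e ℕ.+_) (opposite-prop e)) (ℕₚ.m+[n∸m]≡n (ℕₚ.<⇒≤pred (toℕ<n e)))

-- The block cell with original symbol s. A `just` in the first `Maybe` marks s as a constant, which
-- stays; `just e` in the second marks the diagonal on which the new symbol e displaces s.
inner : {A C E : Set} → A → Maybe C → Maybe E → A ⊎ E
inner s (just _) _ = inj₁ s
inner s nothing (just e) = inj₂ e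
inner s nothing nothing = inj₁ s

inner-nothing : {A C E : Set} (s : A) (c : Maybe C) → inner {E = E} s c nothing ≡ inj₁ s
inner-nothing s (just _) = refl
inner-nothing s nothing = refl

-- A border cell takes over the displaced symbol s. A constant was not displaced, so a new symbol
-- stands there instead.
outer : {A C E : Set} → (C → E) → A → Maybe C → A ⊎ E
outer g s (just c) = inj₂ (g c)
outer g s nothing = inj₁ s

-- The representative q - 1 of -1; the argument only witnesses that q is positive.
greatest : ∀ {q} → Fin q → ∃ λ (x : Fin q) → toℕ x ℕ.+ 1 ≡ q
greatest {ℕ.suc p} _ = fromℕ p , trans (ℕₚ.+-comm _ 1) (cong ℕ.suc (toℕ-fromℕ p))

module OddCase {q k : ℕ} (Z : Residues q) (K : Residues k) (k≤q : k ≤ q)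
  (half : Fin q → Fin q) (half-double : ∀ x → half (Residues._+_ Z x x) ≡ x) where

  open Residues Z

  private
    𝟙 : Fin q
    𝟙 = [ 1ℤ ]

    ι : Fin k → Fin q
    ι e = inject≤ e k≤q

    ι-opposite : ∀ e f → ι e + ι (opposite e) ≡ ι f + ι (opposite f)
    ι-opposite e f = +-cong-toℕ (trans (sum e) (sym (sum f)))
      where
      sum : ∀ e → toℕ (ι e) ℕ.+ toℕ (ι (opposite e)) ≡ k ∸ 1
      sum e = trans (cong₂ ℕ._+_ (toℕ-inject≤ e k≤q) (toℕ-inject≤ (opposite e) k≤q)) (toℕ-opposite e)

  Line : Set
  Line = Fin q ⊎ Fin k

  -- The new symbols missing from block row i are the e for which i + e + 1 is a constant, and e ↦ k
  -- - 1 - (i + e + 1) is an involution of this set. In column j the involution is e ↦ j - e - 1.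
  -- Hence the renamed constants restore exactly what is missing.
  entry : Line → Line → Line
  entry (inj₁ i) (inj₁ j) = let s = half (i + j) in inner s (below k s) (below k (s - i - 𝟙))
  entry (inj₁ i) (inj₂ e) = let s = i + ι e + 𝟙 in outer opposite s (below k s)
  entry (inj₂ e) (inj₁ j) = let s = j - ι e - 𝟙 in outer id s (below k s)
  entry (inj₂ e) (inj₂ f) = inj₁ (ι (Residues._+_ K e f))

  -- Any s with i + j = 2s identifies the cell, so later arguments need not compute with `half`.
  inner-at : ∀ i j s → i + j ≡ s + s → entry (inj₁ i) (inj₁ j) ≡ inner s (below k s) (below k (s - i - 𝟙))
  inner-at i j s eq = cong (λ s → inner s (below k s) (below k (s - i - 𝟙))) (trans (cong half eq) (half-double s))

  rows : ∀ x z → ∃ λ y → entry x y ≡ z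
  rows (inj₁ i) (inj₁ s) with below k s in s≡ | below k (s - i - 𝟙) in e≡
  ... | just _ | _ = inj₁ (s + s - i) , trans
    (inner-at i (s + s - i) s (solve 2 (λ i s → i :+ (s :+ s :- i) := s :+ s) refl i s))
    (cong (λ b → inner s b (below k (s - i - 𝟙))) s≡)
  ... | nothing | nothing = inj₁ (s + s - i) , trans
    (inner-at i (s + s - i) s (solve 2 (λ i s → i :+ (s :+ s :- i) := s :+ s) refl i s))
    (cong₂ (inner s) s≡ e≡)
  -- Here s was displaced from row i by the new symbol e, and border column e takes it over.
  ... | nothing | just e = inj₂ e , trans
    (cong (λ s → outer opposite s (below k s)) (trans
      (cong (λ e → i + e + 𝟙) (below-just _ k≤q e≡))
      (solve 2 (λ i s → i :+ (s :- i :- con 1ℤ) :+ con 1ℤ := s) refl i s)))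
    (cong (outer opposite s) s≡)
  rows (inj₁ i) (inj₂ e) with below k (i + ι e + 𝟙) in s≡
  ... | nothing = let s = i + ι e + 𝟙; j = s + ι e + 𝟙 in inj₁ j , trans
    (inner-at i j s (solve 2 (λ i e → i :+ (i :+ e :+ con 1ℤ :+ e :+ con 1ℤ)
      := i :+ e :+ con 1ℤ :+ (i :+ e :+ con 1ℤ)) refl i (ι e)))
    (cong₂ (inner s) s≡ (trans
      (cong (below k) (solve 2 (λ i e → i :+ e :+ con 1ℤ :- i :- con 1ℤ := e) refl i (ι e)))
      (below-inject≤ e k≤q)))
  -- As f = i + e + 1, column `opposite f` holds i + (k - 1 - f) + 1 = k - 1 - e, a constant whose
  -- renaming is e.
  ... | just f = inj₂ (opposite f) , trans
    (cong (λ s → outer opposite s (below k s)) (begin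
      i + ι (opposite f) + 𝟙
        ≡⟨ solve 4 (λ i e f f′ → i :+ f′ :+ con 1ℤ := i :+ e :+ con 1ℤ :- f :+ (f :+ f′) :- e)
             refl i (ι e) (ι f) (ι (opposite f)) ⟩
      i + ι e + 𝟙 - ι f + (ι f + ι (opposite f)) - ι e
        ≡⟨ cong₂ (λ x y → x - ι f + y - ι e) (sym (below-just _ k≤q s≡)) (ι-opposite f e) ⟩
      ι f - ι f + (ι e + ι (opposite e)) - ι e
        ≡⟨ solve 3 (λ f e e′ → f :- f :+ (e :+ e′) :- e := e′) refl (ι f) (ι e) (ι (opposite e)) ⟩
      ι (opposite e) ∎))
    (trans (cong (outer opposite (ι (opposite e))) (below-inject≤ (opposite e) k≤q))
      (cong inj₂ (opposite-involutive e)))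
    where open ≡-Reasoning
  rows (inj₂ e) (inj₁ s) with below k s in s≡
  ... | just f = inj₂ (proj₁ found) , cong inj₁ (trans (cong ι (proj₁ (proj₂ found))) (below-just s k≤q s≡))
    where found = proj₁ (+-isLatin K) e f
  ... | nothing = inj₁ (s + ι e + 𝟙) , trans
    (cong (λ s → outer id s (below k s)) (solve 2 (λ s e → s :+ e :+ con 1ℤ :- e :- con 1ℤ := s) refl s (ι e)))
    (cong (outer id s) s≡)
  rows (inj₂ e) (inj₂ f) = inj₁ (ι f + ι e + 𝟙) , trans
    (cong (λ s → outer id s (below k s)) (solve 2 (λ s e → s :+ e :+ con 1ℤ :- e :- con 1ℤ := s) refl (ι f) (ι e)))
    (cong (outer id (ι f)) (below-inject≤ f k≤q))

  cols : ∀ y z → ∃ λ x → entry x y ≡ z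
  -- Since s is the midpoint of i and j, s - i = j - s; the diagonal can be read off from the
  -- column.
  cols (inj₁ j) (inj₁ s) with below k s in s≡ | below k (j - s - 𝟙) in e≡
  ... | just _ | _ = inj₁ (s + s - j) , trans
    (inner-at (s + s - j) j s (solve 2 (λ j s → s :+ s :- j :+ j := s :+ s) refl j s))
    (cong (λ b → inner s b (below k (s - (s + s - j) - 𝟙))) s≡)
  ... | nothing | nothing = inj₁ (s + s - j) , trans
    (inner-at (s + s - j) j s (solve 2 (λ j s → s :+ s :- j :+ j := s :+ s) refl j s))
    (cong₂ (inner s) s≡ (trans
      (cong (below k) (solve 2 (λ j s → s :- (s :+ s :- j) :- con 1ℤ := j :- s :- con 1ℤ) refl j s)) e≡))
  ... | nothing | just e = inj₂ e , trans
    (cong (λ s → outer id s (below k s)) (trans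
      (cong (λ e → j - e - 𝟙) (below-just _ k≤q e≡))
      (solve 2 (λ j s → j :- (j :- s :- con 1ℤ) :- con 1ℤ := s) refl j s)))
    (cong (outer id s) s≡)
  cols (inj₁ j) (inj₂ e) with below k (j - ι e - 𝟙) in s≡
  ... | nothing = let s = j - ι e - 𝟙; i = s - ι e - 𝟙 in inj₁ i , trans
    (inner-at i j s (solve 2 (λ j e → j :- e :- con 1ℤ :- e :- con 1ℤ :+ j
      := j :- e :- con 1ℤ :+ (j :- e :- con 1ℤ)) refl j (ι e)))
    (cong₂ (inner s) s≡ (trans
      (cong (below k) (solve 2 (λ j e → j :- e :- con 1ℤ :- (j :- e :- con 1ℤ :- e :- con 1ℤ) :- con 1ℤ := e)
        refl j (ι e)))
      (below-inject≤ e k≤q)))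
  -- The relation j = e + f + 1 is symmetric, so border row f has the constant e here, renamed to
  -- the new symbol e.
  ... | just f = inj₂ f , trans
    (cong (λ s → outer id s (below k s)) (trans
      (cong (λ f → j - f - 𝟙) (below-just _ k≤q s≡))
      (solve 2 (λ j e → j :- (j :- e :- con 1ℤ) :- con 1ℤ := e) refl j (ι e))))
    (cong (outer id (ι e)) (below-inject≤ e k≤q))
  cols (inj₂ e) (inj₁ s) with below k s in s≡
  ... | just f = inj₂ (proj₁ found) , cong inj₁ (trans (cong ι (proj₁ (proj₂ found))) (below-just s k≤q s≡))
    where found = proj₂ (+-isLatin K) e f
  ... | nothing = inj₁ (s - ι e - 𝟙) , trans
    (cong (λ s → outer opposite s (below k s))
      (solve 2 (λ s e → s :- e :- con 1ℤ :+ e :+ con 1ℤ := s) refl s (ι e)))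
    (cong (outer opposite s) s≡)
  cols (inj₂ e) (inj₂ f) = inj₁ (ι (opposite f) - ι e - 𝟙) , trans
    (cong (λ s → outer opposite s (below k s))
      (solve 2 (λ s e → s :- e :- con 1ℤ :+ e :+ con 1ℤ := s) refl (ι (opposite f)) (ι e)))
    (trans (cong (outer opposite (ι (opposite f))) (below-inject≤ (opposite f) k≤q))
      (cong inj₂ (opposite-involutive f)))

  diagonal : ∀ i → entry (inj₁ i) (inj₁ i) ≡ inj₁ i
  diagonal i = trans (inner-at i i i refl) (off-diagonal i)
    where
    off-diagonal : ∀ i → inner i (below k i) (below k (i - i - 𝟙)) ≡ inj₁ i
    off-diagonal i with greatest i | toℕ i ℕ.<? k
    ... | _ | yes i<k = refl
    -- On the main diagonal s - i - 1 is -1, represented by x = q - 1. From k ≤ i ≤ q - 1 it follows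
    -- that x is no e < k, so i stays.
    ... | x , x+1≡q | no i≮k = trans
      (cong (inner i nothing) (trans
        (cong (below k) (trans (solve 1 (λ i → i :- i :- con 1ℤ := :- con 1ℤ) refl i) (neg-[] 1 x x+1≡q)))
        (below-≥ k x (ℕₚ.≤-trans (ℕₚ.≮⇒≥ i≮k)
          (ℕₚ.≤-pred (subst (toℕ i <_) (trans (sym x+1≡q) (ℕₚ.+-comm _ 1)) (toℕ<n i)))))))
      (inner-nothing {C = Fin k} i nothing)

  blueprint : Blueprint q K
  blueprint = record
    { Position = Fin q
    ; index = id
    ; position = id
    ; index-position = λ _ → refl
    ; position-index = λ _ → refl
    ; entry = entry
    ; rows = rows
    ; cols = cols
    ; diagonal = diagonal
    ; const = ι
    ; index-const = λ a → toℕ-inject≤ a k≤q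
    ; corner = λ _ _ → refl
    }

-- m even, k ≥ m - 1

-- The cells with s - i = t of the idempotent square s = (i + j)/2 form the
-- transversal that a prolongation replaces by ∞.
module IdempotentCell {q : ℕ} (Z : Residues q)
  (half : Fin q → Fin q) (half-double : ∀ x → half (Residues._+_ Z x x) ≡ x)
  (t : Fin q) where

  open Residues Z

  abstract
    -- `a` fills the transversal and `b` the other cells, both as functions of the original symbol.
    cell : {A : Set} → (Fin q → A) → (Fin q → A) → Fin q → Fin q → A
    cell a b i j = let s = half (i + j) in if does (s - i ≟ t) then a s else b s

    cell-half : ∀ {A : Set} {a b : Fin q → A} {i j s} → i + j ≡ s + s →
      cell a b i j ≡ (if does (s - i ≟ t) then a s else b s)
    cell-half {a = a} {b} {i} eq =
      cong (λ s → if does (s - i ≟ t) then a s else b s) (trans (cong half eq) (half-double _))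

    cell-on : ∀ {A : Set} {a b : Fin q → A} i j s → i + j ≡ s + s → s - i ≡ t → cell a b i j ≡ a s
    cell-on {a = a} {b} i j s eq on = trans (cell-half eq)
      (cong (λ d → if d then a s else b s) (dec-true (s - i ≟ t) on))

    cell-off : ∀ {A : Set} {a b : Fin q → A} i j s → i + j ≡ s + s → s - i ≢ t → cell a b i j ≡ b s
    cell-off {a = a} {b} i j s eq off = trans (cell-half eq)
      (cong (λ d → if d then a s else b s) (dec-false (s - i ≟ t) off))

  cell-diagonal : ∀ {A : Set} {a b : Fin q → A} → t ≢ [ 0ℤ ] → ∀ i → cell a b i i ≡ b i
  cell-diagonal t≢0 i = cell-off i i i refl λ i-i≡t →
    t≢0 (trans (sym i-i≡t) (solve 1 (λ i → i :- i := con 0ℤ) refl i))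

  reflectʳ : ∀ i s → i + (s + s - i) ≡ s + s
  reflectʳ = solve 2 (λ i s → i :+ (s :+ s :- i) := s :+ s) refl

  reflectˡ : ∀ j s → (s + s - j) + j ≡ s + s
  reflectˡ = solve 2 (λ j s → (s :+ s :- j) :+ j := s :+ s) refl

  reflect-gap : ∀ j s → s - (s + s - j) ≡ j - s
  reflect-gap = solve 2 (λ j s → s :- (s :+ s :- j) := j :- s) refl

  -- Row i meets the transversal in column i + 2t with symbol i + t; prolongation moves this symbol
  -- to column ∞. Dually, column j gives up j - t to row ∞.
  shiftʳ : ∀ i → i + (i + t + t) ≡ i + t + (i + t)
  shiftʳ i = solve 2 (λ i t → i :+ (i :+ t :+ t) := i :+ t :+ (i :+ t)) refl i t

  shiftˡ : ∀ j → (j - t - t) + j ≡ j - t + (j - t)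
  shiftˡ j = solve 2 (λ j t → (j :- t :- t) :+ j := j :- t :+ (j :- t)) refl j t

  gapʳ : ∀ i → i + t - i ≡ t
  gapʳ i = solve 2 (λ i t → i :+ t :- i := t) refl i t

  gapˡ : ∀ j → j - t - (j - t - t) ≡ t
  gapˡ j = solve 2 (λ j t → j :- t :- (j :- t :- t) := t) refl j t

  shift-to : ∀ i s → s - i ≡ t → i + t ≡ s
  shift-to i s refl = solve 2 (λ i s → i :+ (s :- i) := s) refl i s

  shift-from : ∀ j s → j - s ≡ t → j - t ≡ s
  shift-from j s refl = solve 2 (λ j s → j :- (j :- s) := s) refl j s

  shift-unshift : ∀ s → s + t - t ≡ s
  shift-unshift s = solve 2 (λ s t → s :+ t :- t := s) refl s t

  unshift-shift : ∀ s → s - t + t ≡ s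
  unshift-shift s = solve 2 (λ s t → s :- t :+ t := s) refl s t

module EvenCase-k≡m∸1 {q : ℕ} (Z : Residues q)
  (half : Fin q → Fin q) (half-double : ∀ x → half (Residues._+_ Z x x) ≡ x)
  (t : Fin q) (t≢0 : t ≢ Residues.[_] Z 0ℤ) where

  open Residues Z
  open IdempotentCell Z half half-double t

  Line : Set
  Line = Maybe (Fin q) ⊎ Fin q

  pattern ∞ = inj₁ nothing
  pattern old x = inj₁ (just x)
  pattern new x = inj₂ x

  -- The block and both borders are copies of the idempotent square, in old and new symbols
  -- respectively, each losing its transversal. In the borders ∞ takes the vacated cells, in the
  -- block new symbols do. Row and column ∞ absorb the symbols still missing.
  entry : Line → Line → Line
  entry (old i) (old j) = cell new old i j
  entry (old i) (new j) = cell (λ _ → ∞) new i j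
  entry (new i) (old j) = cell (λ _ → ∞) new i j
  entry (new i) (new j) = old (i + j)
  entry (old i) ∞ = old (i + t)
  entry ∞ (old j) = old (j - t)
  entry (new i) ∞ = new (i + t)
  entry ∞ (new j) = new (j - t)
  entry ∞ ∞ = ∞

  rows : ∀ x z → ∃ λ y → entry x y ≡ z
  rows (old i) (old s) with s - i ≟ t
  ... | yes on = ∞ , cong old (shift-to i s on)
  ... | no off = old (s + s - i) , cell-off i _ s (reflectʳ i s) off
  rows (old i) (new s) with s - i ≟ t
  ... | yes on = old (s + s - i) , cell-on i _ s (reflectʳ i s) on
  ... | no off = new (s + s - i) , cell-off i _ s (reflectʳ i s) off
  rows (old i) ∞ = new (i + t + t) , cell-on i _ (i + t) (shiftʳ i) (gapʳ i)
  rows (new i) (old s) = new (s - i) , cong old (solve 2 (λ i s → i :+ (s :- i) := s) refl i s)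
  rows (new i) (new s) with s - i ≟ t
  ... | yes on = ∞ , cong new (shift-to i s on)
  ... | no off = old (s + s - i) , cell-off i _ s (reflectʳ i s) off
  rows (new i) ∞ = old (i + t + t) , cell-on i _ (i + t) (shiftʳ i) (gapʳ i)
  rows ∞ (old s) = old (s + t) , cong old (shift-unshift s)
  rows ∞ (new s) = new (s + t) , cong new (shift-unshift s)
  rows ∞ ∞ = ∞ , refl

  cols : ∀ y z → ∃ λ x → entry x y ≡ z
  cols (old j) (old s) with j - s ≟ t
  ... | yes on = ∞ , cong old (shift-from j s on)
  ... | no off = old (s + s - j) , cell-off _ j s (reflectˡ j s) (off ∘ trans (sym (reflect-gap j s)))
  cols (old j) (new s) with j - s ≟ t
  ... | yes on = old (s + s - j) , cell-on _ j s (reflectˡ j s) (trans (reflect-gap j s) on)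
  ... | no off = new (s + s - j) , cell-off _ j s (reflectˡ j s) (off ∘ trans (sym (reflect-gap j s)))
  cols (old j) ∞ = new (j - t - t) , cell-on _ j (j - t) (shiftˡ j) (gapˡ j)
  cols (new j) (old s) = new (s - j) , cong old (solve 2 (λ j s → (s :- j) :+ j := s) refl j s)
  cols (new j) (new s) with j - s ≟ t
  ... | yes on = ∞ , cong new (shift-from j s on)
  ... | no off = old (s + s - j) , cell-off _ j s (reflectˡ j s) (off ∘ trans (sym (reflect-gap j s)))
  cols (new j) ∞ = old (j - t - t) , cell-on _ j (j - t) (shiftˡ j) (gapˡ j)
  cols ∞ (old s) = old (s - t) , cong old (unshift-shift s)
  cols ∞ (new s) = new (s - t) , cong new (unshift-shift s)
  cols ∞ ∞ = ∞ , refl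

  diagonal : ∀ p → entry (inj₁ p) (inj₁ p) ≡ inj₁ p
  diagonal (just i) = cell-diagonal t≢0 i
  diagonal nothing = refl

  -- ∞ comes last, because here the constants are exactly the finite points and need the indices
  -- below k.
  index : Maybe (Fin q) → Fin (ℕ.suc q)
  index = maybe inject₁ (fromℕ q)

  position : Fin (ℕ.suc q) → Maybe (Fin q)
  position = below q

  position-index : ∀ p → position (index p) ≡ p
  position-index nothing = below-≥ q (fromℕ q) (ℕₚ.≤-reflexive (sym (toℕ-fromℕ q)))
  position-index (just i) = trans
    (cong (below q) (toℕ-injective (trans (toℕ-inject₁ i) (sym (toℕ-inject≤ i (ℕₚ.n≤1+n q))))))
    (below-inject≤ i (ℕₚ.n≤1+n q))

  index-position : ∀ i → index (position i) ≡ i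
  index-position i with toℕ i ℕ.<? q
  ... | yes i<q = toℕ-injective (trans (toℕ-inject₁ _) (toℕ-fromℕ< i<q))
  ... | no i≮q = toℕ-injective (trans (toℕ-fromℕ q)
    (ℕₚ.≤-antisym (ℕₚ.≮⇒≥ i≮q) (ℕₚ.≤-pred (toℕ<n i))))

  blueprint : Blueprint (ℕ.suc q) Z
  blueprint = record
    { Position = Maybe (Fin q)
    ; index = index
    ; position = position
    ; index-position = index-position
    ; position-index = position-index
    ; entry = entry
    ; rows = rows
    ; cols = cols
    ; diagonal = diagonal
    ; const = just
    ; index-const = toℕ-inject₁
    ; corner = λ _ _ → refl
    }

-- ∞ comes first in this numbering, where it serves as the constant 0.
fromMaybe : ∀ {q} → Maybe (Fin q) → Fin (ℕ.suc q)
fromMaybe = maybe suc zero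

toMaybe : ∀ {q} → Fin (ℕ.suc q) → Maybe (Fin q)
toMaybe zero = nothing
toMaybe (suc i) = just i

fromMaybe-toMaybe : ∀ {q} (i : Fin (ℕ.suc q)) → fromMaybe (toMaybe i) ≡ i
fromMaybe-toMaybe zero = refl
fromMaybe-toMaybe (suc i) = refl

toMaybe-fromMaybe : ∀ {q} (p : Maybe (Fin q)) → toMaybe (fromMaybe p) ≡ p
toMaybe-fromMaybe nothing = refl
toMaybe-fromMaybe (just i) = refl

module EvenCase-k≡m {q : ℕ} (Z : Residues q) (K : Residues (ℕ.suc q))
  (half : Fin q → Fin q) (half-double : ∀ x → half (Residues._+_ Z x x) ≡ x)
  (t : Fin q) (t≢0 : t ≢ Residues.[_] Z 0ℤ) where

  open Residues Z
  open IdempotentCell Z half half-double t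
  module K = Residues K

  Position : Set
  Position = Maybe (Fin q)

  square : Position → Position → Position
  square (just i) (just j) = cell (λ _ → nothing) just i j
  square (just i) nothing = just (i + t)
  square nothing (just j) = just (j - t)
  square nothing nothing = nothing

  square-rows : ∀ p r → ∃ λ p′ → square p p′ ≡ r
  square-rows (just i) (just s) with s - i ≟ t
  ... | yes on = nothing , cong just (shift-to i s on)
  ... | no off = just (s + s - i) , cell-off i _ s (reflectʳ i s) off
  square-rows (just i) nothing = just (i + t + t) , cell-on i _ (i + t) (shiftʳ i) (gapʳ i)
  square-rows nothing (just s) = just (s + t) , cong just (shift-unshift s)
  square-rows nothing nothing = nothing , refl

  square-cols : ∀ p r → ∃ λ p′ → square p′ p ≡ r
  square-cols (just j) (just s) with j - s ≟ t
  ... | yes on = nothing , cong just (shift-from j s on)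
  ... | no off = just (s + s - j) , cell-off _ j s (reflectˡ j s) (off ∘ trans (sym (reflect-gap j s)))
  square-cols (just j) nothing = just (j - t - t) , cell-on _ j (j - t) (shiftˡ j) (gapˡ j)
  square-cols nothing (just s) = just (s - t) , cong just (unshift-shift s)
  square-cols nothing nothing = nothing , refl

  Line : Set
  Line = Position ⊎ Fin (ℕ.suc q)

  entry : Line → Line → Line
  entry (inj₁ p) (inj₁ r) = inj₁ (square p r)
  entry (inj₁ p) (inj₂ e) = inj₂ (fromMaybe p K.+ e)
  entry (inj₂ e) (inj₁ p) = inj₂ (e K.+ fromMaybe p)
  entry (inj₂ e) (inj₂ f) = inj₁ (toMaybe (e K.+ f))

  rows : ∀ x z → ∃ λ y → entry x y ≡ z
  rows (inj₁ p) (inj₁ r) = let r′ , eq = square-rows p r in inj₁ r′ , cong inj₁ eq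
  rows (inj₁ p) (inj₂ f) = let e , eq , _ = proj₁ (+-isLatin K) (fromMaybe p) f in inj₂ e , cong inj₂ eq
  rows (inj₂ e) (inj₁ p) = let f , eq , _ = proj₁ (+-isLatin K) e (fromMaybe p) in
    inj₂ f , cong inj₁ (trans (cong toMaybe eq) (toMaybe-fromMaybe p))
  rows (inj₂ e) (inj₂ f) = let g , eq , _ = proj₁ (+-isLatin K) e f in
    inj₁ (toMaybe g) , cong inj₂ (trans (cong (e K.+_) (fromMaybe-toMaybe g)) eq)

  cols : ∀ y z → ∃ λ x → entry x y ≡ z
  cols (inj₁ p) (inj₁ r) = let r′ , eq = square-cols p r in inj₁ r′ , cong inj₁ eq
  cols (inj₁ p) (inj₂ f) = let e , eq , _ = proj₂ (+-isLatin K) (fromMaybe p) f in inj₂ e , cong inj₂ eq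
  cols (inj₂ e) (inj₁ p) = let f , eq , _ = proj₂ (+-isLatin K) e (fromMaybe p) in
    inj₂ f , cong inj₁ (trans (cong toMaybe eq) (toMaybe-fromMaybe p))
  cols (inj₂ e) (inj₂ f) = let g , eq , _ = proj₂ (+-isLatin K) e f in
    inj₁ (toMaybe g) , cong inj₂ (trans (cong (K._+ e) (fromMaybe-toMaybe g)) eq)

  diagonal : ∀ p → entry (inj₁ p) (inj₁ p) ≡ inj₁ p
  diagonal (just i) = cong inj₁ (cell-diagonal t≢0 i)
  diagonal nothing = refl

  blueprint : Blueprint (ℕ.suc q) K
  blueprint = record
    { Position = Position
    ; index = fromMaybe
    ; position = toMaybe
    ; index-position = fromMaybe-toMaybe
    ; position-index = toMaybe-fromMaybe
    ; entry = entry
    ; rows = rows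
    ; cols = cols
    ; diagonal = diagonal
    ; const = toMaybe
    ; index-const = λ a → cong toℕ (fromMaybe-toMaybe a)
    ; corner = λ _ _ → refl
    }

-- m even, k ≤ m - 3

toℕ-punchIn-< : ∀ {n} (a : Fin (ℕ.suc n)) (s : Fin n) → toℕ s < toℕ a → toℕ (punchIn a s) ≡ toℕ s
toℕ-punchIn-< (suc a) zero _ = refl
toℕ-punchIn-< (suc a) (suc s) s<a = cong ℕ.suc (toℕ-punchIn-< a s (ℕₚ.≤-pred s<a))

toℕ-punchIn-≥ : ∀ {n} (a : Fin (ℕ.suc n)) (s : Fin n) → toℕ a ≤ toℕ s → toℕ (punchIn a s) ≡ ℕ.suc (toℕ s)
toℕ-punchIn-≥ zero s _ = refl
toℕ-punchIn-≥ (suc a) (suc s) a≤s = cong ℕ.suc (toℕ-punchIn-≥ a s (ℕₚ.≤-pred a≤s))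

-- The map (f , s) ↦ (punchIn (opposite f) s , s + f - punchIn (opposite f) s)
-- is an involution.
punchIn-opposite : ∀ {k} (f : Fin (ℕ.suc k)) (s : Fin k) → let e = punchIn (opposite f) s in
  ∃ λ s′ → punchIn (opposite e) s′ ≡ f × toℕ s′ ℕ.+ toℕ e ≡ toℕ s ℕ.+ toℕ f
punchIn-opposite {k} f s with toℕ s ℕ.<? toℕ (opposite f)
-- In this case e = s and s′ = f: the map swaps its two arguments.
... | yes s<f̄ = s′ , toℕ-injective (trans (toℕ-punchIn-< (opposite e) s′
      (subst (_< toℕ (opposite e)) (sym s′≡f) f<ē)) s′≡f) ,
    trans (cong₂ ℕ._+_ s′≡f e≡s) (ℕₚ.+-comm (toℕ f) (toℕ s))
  where
  e = punchIn (opposite f) s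

  e≡s : toℕ e ≡ toℕ s
  e≡s = toℕ-punchIn-< (opposite f) s s<f̄

  f+s<k : toℕ f ℕ.+ toℕ s < k
  f+s<k = subst (toℕ f ℕ.+ toℕ s <_) (toℕ-opposite f) (ℕₚ.+-monoʳ-< (toℕ f) s<f̄)

  f<k : toℕ f < k
  f<k = ℕₚ.≤-<-trans (ℕₚ.m≤m+n (toℕ f) (toℕ s)) f+s<k

  s′ = fromℕ< f<k

  s′≡f : toℕ s′ ≡ toℕ f
  s′≡f = toℕ-fromℕ< f<k

  f<ē : toℕ f < toℕ (opposite e)
  f<ē = ℕₚ.+-cancelˡ-< (toℕ s) _ _ (ℕₚ.<-≤-trans
    (subst (_< k) (ℕₚ.+-comm (toℕ f) (toℕ s)) f+s<k)
    (ℕₚ.≤-reflexive (sym (trans (cong (ℕ._+ toℕ (opposite e)) (sym e≡s)) (toℕ-opposite e)))))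
-- In this case e = s + 1 and s′ = f - 1. The value f = 0 cannot occur, since then `opposite f`
-- would be k, which exceeds s.
... | no s≮f̄ = helper f refl
  where
  e = punchIn (opposite f) s

  f̄≤s : toℕ (opposite f) ≤ toℕ s
  f̄≤s = ℕₚ.≮⇒≥ s≮f̄

  e≡1+s : toℕ e ≡ ℕ.suc (toℕ s)
  e≡1+s = toℕ-punchIn-≥ (opposite f) s f̄≤s

  helper : ∀ f′ → f′ ≡ f → ∃ λ s′ → punchIn (opposite e) s′ ≡ f′ × toℕ s′ ℕ.+ toℕ e ≡ toℕ s ℕ.+ toℕ f′
  helper zero refl = ⊥-elim (ℕₚ.<⇒≱ (toℕ<n s) (subst (_≤ toℕ s) (toℕ-opposite f) f̄≤s))
  helper (suc g) refl = g , toℕ-injective (toℕ-punchIn-≥ (opposite e) g ē≤g) ,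
      trans (cong (toℕ g ℕ.+_) e≡1+s) (trans (ℕₚ.+-suc (toℕ g) (toℕ s))
        (trans (cong ℕ.suc (ℕₚ.+-comm (toℕ g) (toℕ s))) (sym (ℕₚ.+-suc (toℕ s) (toℕ g)))))
    where
    ē≤g : toℕ (opposite e) ≤ toℕ g
    ē≤g = ℕₚ.+-cancelˡ-≤ (ℕ.suc (toℕ s)) _ _ (begin
      ℕ.suc (toℕ s) ℕ.+ toℕ (opposite e)   ≡⟨ cong (ℕ._+ toℕ (opposite e)) e≡1+s ⟨
      toℕ e ℕ.+ toℕ (opposite e)           ≡⟨ toℕ-opposite e ⟩
      k                                    ≡⟨ toℕ-opposite f ⟨
      ℕ.suc (toℕ g) ℕ.+ toℕ (opposite f)   ≤⟨ ℕₚ.+-monoʳ-≤ (ℕ.suc (toℕ g)) f̄≤s ⟩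
      ℕ.suc (toℕ g ℕ.+ toℕ s)              ≡⟨ cong ℕ.suc (ℕₚ.+-comm (toℕ g) (toℕ s)) ⟩
      ℕ.suc (toℕ s) ℕ.+ toℕ g              ∎)
      where open ℕₚ.≤-Reasoning

-- Here `k` counts the finite constants, so with ∞ there are `suc k` constants and as many new
-- symbols. The bound on q keeps the diagonals s - i = e + 1 apart from the main diagonal and from
-- the transversal s - i = -1.
module EvenCase-k≤m∸3 {q k : ℕ} (Z : Residues q) (K : Residues (ℕ.suc k)) (k+3≤q : k ℕ.+ 3 ≤ q)
  (half : Fin q → Fin q) (half-double : ∀ x → half (Residues._+_ Z x x) ≡ x)
  (t≢0 : Residues.neg Z (Residues.[_] Z 1ℤ) ≢ Residues.[_] Z 0ℤ) where

  open Residues Z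
  module K = Residues K

  private
    𝟙 t : Fin q
    𝟙 = [ 1ℤ ]
    t = neg 𝟙

    1+k≤q : ℕ.suc k ≤ q
    1+k≤q = ℕₚ.≤-trans (subst (_≤ k ℕ.+ 3) (ℕₚ.+-comm k 1) (ℕₚ.+-monoʳ-≤ k (ℕ.s≤s ℕ.z≤n))) k+3≤q

    k≤q : k ≤ q
    k≤q = ℕₚ.<⇒≤ 1+k≤q

    ι : Fin (ℕ.suc k) → Fin q
    ι e = inject≤ e 1+k≤q

    κ : Fin k → Fin q
    κ s = inject≤ s k≤q

    κ-opposite : ∀ e f → κ e + κ (opposite e) ≡ κ f + κ (opposite f)
    κ-opposite e f = +-cong-toℕ (trans (sum e) (sym (sum f)))
      where
      sum : ∀ e → toℕ (κ e) ℕ.+ toℕ (κ (opposite e)) ≡ k ∸ 1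
      sum e = trans (cong₂ ℕ._+_ (toℕ-inject≤ e k≤q) (toℕ-inject≤ (opposite e) k≤q)) (toℕ-opposite e)

    κ+ι : ∀ {s s′ e e′} → toℕ s ℕ.+ toℕ e ≡ toℕ s′ ℕ.+ toℕ e′ → κ s + ι e ≡ κ s′ + ι e′
    κ+ι {s} {s′} {e} {e′} eq = +-cong-toℕ (trans (cong₂ ℕ._+_ (toℕ-inject≤ s k≤q) (toℕ-inject≤ e 1+k≤q))
      (trans eq (sym (cong₂ ℕ._+_ (toℕ-inject≤ s′ k≤q) (toℕ-inject≤ e′ 1+k≤q)))))

    -- No reduction occurs: e + 1 ≤ k + 1 < q - 1, and q - 1 represents t.
    ι+𝟙≢t : ∀ e → ι e + 𝟙 ≢ t
    ι+𝟙≢t e eq = ℕₚ.<-irrefl (trans (cong (ℕ._+ 1) (sym toℕ-y)) (trans (cong (λ y → toℕ y ℕ.+ 1) y≡x) x+1≡q)) e+2<q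
      where
      open ≡-Reasoning
      x = proj₁ (greatest (ι e))
      x+1≡q = proj₂ (greatest (ι e))

      e+2<q : toℕ e ℕ.+ 1 ℕ.+ 1 < q
      e+2<q = ℕₚ.<-≤-trans (ℕₚ.+-monoˡ-< 1 (ℕₚ.+-monoˡ-< 1 (toℕ<n e)))
        (subst (_≤ q) (trans (ℕₚ.+-suc k 2) (sym (ℕₚ.+-assoc (ℕ.suc k) 1 1))) k+3≤q)

      e+1<q : toℕ e ℕ.+ 1 < q
      e+1<q = ℕₚ.≤-<-trans (ℕₚ.m≤m+n _ 1) e+2<q

      y : Fin q
      y = fromℕ< e+1<q

      toℕ-y : toℕ y ≡ toℕ e ℕ.+ 1
      toℕ-y = toℕ-fromℕ< e+1<q

      y≡x : y ≡ x
      y≡x = begin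
        y                            ≡⟨ []-toℕ y ⟨
        [ ℤ.+ toℕ y ]                ≡⟨ cong (λ n → [ ℤ.+ n ]) toℕ-y ⟩
        [ ℤ.+ (toℕ e ℕ.+ 1) ]        ≡⟨ []-+ (ℤ.+ toℕ e) 1ℤ ⟩
        [ ℤ.+ toℕ e ] + 𝟙            ≡⟨ cong (λ n → [ ℤ.+ n ] + 𝟙) (toℕ-inject≤ e 1+k≤q) ⟨
        [ ℤ.+ toℕ (ι e) ] + 𝟙        ≡⟨ cong (_+ 𝟙) ([]-toℕ (ι e)) ⟩
        ι e + 𝟙                      ≡⟨ eq ⟩
        t                            ≡⟨ neg-[] 1 x x+1≡q ⟩
        x                            ∎

  open IdempotentCell Z half half-double t

  Line : Set
  Line = Maybe (Fin q) ⊎ Fin (ℕ.suc k)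

  pattern ∞ = inj₁ nothing
  pattern old x = inj₁ (just x)
  pattern new x = inj₂ x

  const : Fin (ℕ.suc k) → Maybe (Fin q)
  const zero = nothing
  const (suc s) = just (κ s)

  -- A border line contains k - 1 displaced finite constants but must receive k
  -- new symbols; opposite e is the one that goes to row or column ∞, and
  -- punchIn enumerates the others.
  filled : Fin q → Fin q → Line
  filled i s = inner (just s) (below k s) (below (ℕ.suc k) (s - i - 𝟙))

  right : Fin (ℕ.suc k) → Fin q → Line
  right e s = outer (punchIn (opposite e) ∘ opposite) (just s) (below k s)

  bottom : Fin (ℕ.suc k) → Fin q → Line
  bottom e s = outer (punchIn (opposite e)) (just s) (below k s)

  entry : Line → Line → Line
  entry (old i) (old j) = cell (λ _ → ∞) (filled i) i j
  entry (old i) ∞ = old (i + t)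
  entry ∞ (old j) = old (j - t)
  entry ∞ ∞ = ∞
  entry (old i) (new e) = right e (i + ι e + 𝟙)
  entry ∞ (new e) = new (opposite e)
  entry (new e) (old j) = bottom e (j - ι e - 𝟙)
  entry (new e) ∞ = new (opposite e)
  entry (new e) (new f) = inj₁ (const (e K.+ f))

  rows : ∀ x z → ∃ λ y → entry x y ≡ z
  rows (old i) (old s) with s - i ≟ t | below k s in s≡ | below (ℕ.suc k) (s - i - 𝟙) in e≡
  ... | yes on | _ | _ = ∞ , cong old (shift-to i s on)
  ... | no off | just _ | _ = old (s + s - i) , trans (cell-off i _ s (reflectʳ i s) off)
    (cong (λ c → inner (just s) c (below (ℕ.suc k) (s - i - 𝟙))) s≡)
  ... | no off | nothing | nothing = old (s + s - i) , trans (cell-off i _ s (reflectʳ i s) off)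
    (cong₂ (inner (just s)) s≡ e≡)
  ... | no off | nothing | just e = new e , trans
    (cong (right e) (trans
      (cong (λ e → i + e + 𝟙) (below-just _ 1+k≤q e≡))
      (solve 2 (λ i s → i :+ (s :- i :- con 1ℤ) :+ con 1ℤ := s) refl i s)))
    (cong (outer (punchIn (opposite e) ∘ opposite) (just s)) s≡)
  rows (old i) ∞ = old (i + t + t) , cell-on i _ (i + t) (shiftʳ i) (gapʳ i)
  rows (old i) (new f) with below k (i + ι f + 𝟙) in s≡
  ... | nothing = let s = i + ι f + 𝟙 in old (s + ι f + 𝟙) , trans
    (cell-off i _ s
      (solve 2 (λ i e → i :+ (i :+ e :+ con 1ℤ :+ e :+ con 1ℤ)
        := i :+ e :+ con 1ℤ :+ (i :+ e :+ con 1ℤ)) refl i (ι f))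
      (ι+𝟙≢t f ∘ trans (solve 2 (λ i e → e :+ con 1ℤ := i :+ e :+ con 1ℤ :- i) refl i (ι f))))
    (cong₂ (inner (just s)) s≡ (trans
      (cong (below (ℕ.suc k)) (solve 2 (λ i e → i :+ e :+ con 1ℤ :- i :- con 1ℤ := e) refl i (ι f)))
      (below-inject≤ f 1+k≤q)))
  -- The involution yields e and s′ with s′ + e = `opposite s` + f. As a constant and its opposite
  -- have a fixed sum, i + e + 1 is `opposite s′`, which border column e renames to f.
  ... | just s with punchIn-opposite f (opposite s)
  ...   | s′ , f≡ , sum = let e = punchIn (opposite f) (opposite s) in new e , trans
    (cong (right e) (begin
      i + ι e + 𝟙
        ≡⟨ solve 4 (λ i e f s′ → i :+ e :+ con 1ℤ := i :+ f :+ con 1ℤ :+ (s′ :+ e) :- f :- s′)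
             refl i (ι e) (ι f) (κ s′) ⟩
      i + ι f + 𝟙 + (κ s′ + ι e) - ι f - κ s′
        ≡⟨ cong₂ (λ x y → x + y - ι f - κ s′) (sym (below-just _ k≤q s≡)) (κ+ι sum) ⟩
      κ s + (κ (opposite s) + ι f) - ι f - κ s′
        ≡⟨ solve 4 (λ s s̄ f s′ → s :+ (s̄ :+ f) :- f :- s′ := s :+ s̄ :- s′)
             refl (κ s) (κ (opposite s)) (ι f) (κ s′) ⟩
      κ s + κ (opposite s) - κ s′
        ≡⟨ cong (_- κ s′) (κ-opposite s s′) ⟩
      κ s′ + κ (opposite s′) - κ s′
        ≡⟨ solve 2 (λ s′ s̄′ → s′ :+ s̄′ :- s′ := s̄′) refl (κ s′) (κ (opposite s′)) ⟩
      κ (opposite s′) ∎))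
    (trans (cong (outer (punchIn (opposite e) ∘ opposite) _) (below-inject≤ (opposite s′) k≤q))
      (cong inj₂ (trans (cong (punchIn (opposite e)) (opposite-involutive s′)) f≡)))
    where open ≡-Reasoning
  rows ∞ (old s) = old (s + t) , cong old (shift-unshift s)
  rows ∞ ∞ = ∞ , refl
  rows ∞ (new f) = new (opposite f) , cong inj₂ (opposite-involutive f)
  rows (new e) (old s) with below k s in s≡
  ... | just c = let f , eq , _ = proj₁ (+-isLatin K) e (suc c) in
    new f , cong inj₁ (trans (cong const eq) (cong just (below-just s k≤q s≡)))
  ... | nothing = old (s + ι e + 𝟙) , trans
    (cong (bottom e) (solve 2 (λ s e → s :+ e :+ con 1ℤ :- e :- con 1ℤ := s) refl s (ι e)))
    (cong (outer (punchIn (opposite e)) (just s)) s≡)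
  rows (new e) ∞ = let f , eq , _ = proj₁ (+-isLatin K) e zero in new f , cong inj₁ (cong const eq)
  rows (new e) (new f) with opposite e ≟ f
  ... | yes ē≡f = ∞ , cong inj₂ ē≡f
  ... | no ē≢f = let s = punchOut ē≢f in old (κ s + ι e + 𝟙) , trans
    (cong (bottom e) (solve 2 (λ s e → s :+ e :+ con 1ℤ :- e :- con 1ℤ := s) refl (κ s) (ι e)))
    (trans (cong (outer (punchIn (opposite e)) _) (below-inject≤ s k≤q)) (cong inj₂ (punchIn-punchOut ē≢f)))

  cols : ∀ y z → ∃ λ x → entry x y ≡ z
  cols (old j) (old s) with j - s ≟ t | below k s in s≡ | below (ℕ.suc k) (j - s - 𝟙) in e≡
  ... | yes on | _ | _ = ∞ , cong old (shift-from j s on)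
  ... | no off | just _ | _ = old (s + s - j) , trans
    (cell-off _ j s (reflectˡ j s) (off ∘ trans (sym (reflect-gap j s))))
    (cong (λ c → inner (just s) c (below (ℕ.suc k) (s - (s + s - j) - 𝟙))) s≡)
  ... | no off | nothing | nothing = old (s + s - j) , trans
    (cell-off _ j s (reflectˡ j s) (off ∘ trans (sym (reflect-gap j s))))
    (cong₂ (inner (just s)) s≡ (trans (cong (λ d → below (ℕ.suc k) (d - 𝟙)) (reflect-gap j s)) e≡))
  ... | no off | nothing | just e = new e , trans
    (cong (bottom e) (trans
      (cong (λ e → j - e - 𝟙) (below-just _ 1+k≤q e≡))
      (solve 2 (λ j s → j :- (j :- s :- con 1ℤ) :- con 1ℤ := s) refl j s)))
    (cong (outer (punchIn (opposite e)) (just s)) s≡)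
  cols (old j) ∞ = old (j - t - t) , cell-on _ j (j - t) (shiftˡ j) (gapˡ j)
  cols (old j) (new f) with below k (j - ι f - 𝟙) in s≡
  ... | nothing = let s = j - ι f - 𝟙; i = s - ι f - 𝟙 in old i , trans
    (cell-off i j s
      (solve 2 (λ j e → j :- e :- con 1ℤ :- e :- con 1ℤ :+ j
        := j :- e :- con 1ℤ :+ (j :- e :- con 1ℤ)) refl j (ι f))
      (ι+𝟙≢t f ∘ trans (solve 2 (λ j e → e :+ con 1ℤ
        := j :- e :- con 1ℤ :- (j :- e :- con 1ℤ :- e :- con 1ℤ)) refl j (ι f))))
    (cong₂ (inner (just s)) s≡ (trans
      (cong (below (ℕ.suc k)) (solve 2 (λ j e → j :- e :- con 1ℤ :- (j :- e :- con 1ℤ :- e :- con 1ℤ) :- con 1ℤ := e)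
        refl j (ι f)))
      (below-inject≤ f 1+k≤q)))
  -- Now s′ + e = s + f turns j - f - 1 = s into j - e - 1 = s′, which border row e renames to f.
  ... | just s with punchIn-opposite f s
  ...   | s′ , f≡ , sum = let e = punchIn (opposite f) s in new e , trans
    (cong (bottom e) (begin
      j - ι e - 𝟙
        ≡⟨ solve 4 (λ j e f s′ → j :- e :- con 1ℤ := s′ :+ (j :- f :- con 1ℤ :+ f) :- (s′ :+ e))
             refl j (ι e) (ι f) (κ s′) ⟩
      κ s′ + (j - ι f - 𝟙 + ι f) - (κ s′ + ι e)
        ≡⟨ cong₂ (λ x y → κ s′ + (x + ι f) - y) (sym (below-just _ k≤q s≡)) (κ+ι sum) ⟩
      κ s′ + (κ s + ι f) - (κ s + ι f)
        ≡⟨ solve 2 (λ s′ x → s′ :+ x :- x := s′) refl (κ s′) (κ s + ι f) ⟩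
      κ s′ ∎))
    (trans (cong (outer (punchIn (opposite e)) _) (below-inject≤ s′ k≤q)) (cong inj₂ f≡))
    where open ≡-Reasoning
  cols ∞ (old s) = old (s - t) , cong old (unshift-shift s)
  cols ∞ ∞ = ∞ , refl
  cols ∞ (new f) = new (opposite f) , cong inj₂ (opposite-involutive f)
  cols (new e) (old s) with below k s in s≡
  ... | just c = let f , eq , _ = proj₂ (+-isLatin K) e (suc c) in
    new f , cong inj₁ (trans (cong const eq) (cong just (below-just s k≤q s≡)))
  ... | nothing = old (s - ι e - 𝟙) , trans
    (cong (right e) (solve 2 (λ s e → s :- e :- con 1ℤ :+ e :+ con 1ℤ := s) refl s (ι e)))
    (cong (outer (punchIn (opposite e) ∘ opposite) (just s)) s≡)
  cols (new e) ∞ = let f , eq , _ = proj₂ (+-isLatin K) e zero in new f , cong inj₁ (cong const eq)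
  cols (new e) (new f) with opposite e ≟ f
  ... | yes ē≡f = ∞ , cong inj₂ ē≡f
  ... | no ē≢f = let s = punchOut ē≢f; s̄ = opposite s in old (κ s̄ - ι e - 𝟙) , trans
    (cong (right e) (solve 2 (λ s e → s :- e :- con 1ℤ :+ e :+ con 1ℤ := s) refl (κ s̄) (ι e)))
    (trans (cong (outer (punchIn (opposite e) ∘ opposite) _) (below-inject≤ s̄ k≤q))
      (cong inj₂ (trans (cong (punchIn (opposite e)) (opposite-involutive s)) (punchIn-punchOut ē≢f))))

  diagonal : ∀ p → entry (inj₁ p) (inj₁ p) ≡ inj₁ p
  diagonal nothing = refl
  diagonal (just i) = trans (cell-diagonal t≢0 i) (trans
    (cong (inner (just i) (below k i)) (trans
      (cong (below (ℕ.suc k)) (trans (solve 1 (λ i → i :- i :- con 1ℤ := :- con 1ℤ) refl i) (neg-[] 1 x x+1≡q)))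
      (below-≥ (ℕ.suc k) x (ℕₚ.+-cancelʳ-≤ 1 _ _ (subst (ℕ.suc k ℕ.+ 1 ≤_) (sym x+1≡q)
        (ℕₚ.≤-trans (subst (_≤ k ℕ.+ 3) (ℕₚ.+-suc k 1) (ℕₚ.+-monoʳ-≤ k (ℕ.s≤s (ℕ.s≤s ℕ.z≤n)))) k+3≤q))))))
    (inner-nothing (just i) (below k i)))
    where
    x = proj₁ (greatest i)
    x+1≡q = proj₂ (greatest i)

  blueprint : Blueprint (ℕ.suc q) K
  blueprint = record
    { Position = Maybe (Fin q)
    ; index = fromMaybe
    ; position = toMaybe
    ; index-position = fromMaybe-toMaybe
    ; position-index = toMaybe-fromMaybe
    ; entry = entry
    ; rows = rows
    ; cols = cols
    ; diagonal = diagonal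
    ; const = const
    ; index-const = λ { zero → refl ; (suc s) → cong ℕ.suc (toℕ-inject≤ s k≤q) }
    ; corner = λ _ _ → refl
    }

-- m even, k = m - 2

module SkipTwo {k : ℕ} {x y : Fin (ℕ.suc (ℕ.suc k))} (x≢y : x ≢ y) where

  skip : Fin k → Fin (ℕ.suc (ℕ.suc k))
  skip e = punchIn x (punchIn (punchOut x≢y) e)

  skip≢ˡ : ∀ e → skip e ≢ x
  skip≢ˡ e = punchInᵢ≢i x _

  skip≢ʳ : ∀ e → skip e ≢ y
  skip≢ʳ e eq = punchInᵢ≢i (punchOut x≢y) e
    (punchIn-injective x _ _ (trans eq (sym (punchIn-punchOut x≢y))))

  skip-injective : ∀ {e f} → skip e ≡ skip f → e ≡ f
  skip-injective = punchIn-injective (punchOut x≢y) _ _ ∘ punchIn-injective x _ _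

  skip-surjective : ∀ {z} → z ≢ x → z ≢ y → ∃ λ e → skip e ≡ z
  skip-surjective {z} z≢x z≢y = punchOut y′≢z′ ,
    trans (cong (punchIn x) (punchIn-punchOut y′≢z′)) (punchIn-punchOut x≢z)
    where
    x≢z : x ≢ z
    x≢z = z≢x ∘ sym

    y′≢z′ : punchOut x≢y ≢ punchOut x≢z
    y′≢z′ eq = z≢y (trans (sym (punchIn-punchOut x≢z))
      (trans (cong (punchIn x) (sym eq)) (punchIn-punchOut x≢y)))

-- Position δ is the cell of the m × m block in row rowOf δ and column colOf δ of
-- ℤ/m, with difference δ, except that position 0 has difference η = m/2. Thus the
-- constants are the positions other than 0 and η. In terms of ℤ/m, cells with
-- difference η or 0 in row x hold the symbols x and x + 1, named by `name`.
module EvenCase-k≡m∸2 {k : ℕ} (Z : Residues (ℕ.suc (ℕ.suc k))) (K : Residues k)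
  (η : Fin (ℕ.suc (ℕ.suc k)))
  (η+η≡0 : Residues._+_ Z η η ≡ Residues.[_] Z 0ℤ)
  (0≢η : Residues.[_] Z 0ℤ ≢ η) (0≢1 : Residues.[_] Z 0ℤ ≢ Residues.[_] Z 1ℤ) (1≢η : Residues.[_] Z 1ℤ ≢ η)
  (rowOf : Fin (ℕ.suc (ℕ.suc k)) → Fin (ℕ.suc (ℕ.suc k)))
  (colOf : Fin (ℕ.suc (ℕ.suc k)) → Fin (ℕ.suc (ℕ.suc k)))
  (row-surjective : ∀ x → ∃ λ δ → rowOf δ ≡ x) (col-surjective : ∀ x → ∃ λ δ → colOf δ ≡ x)
  (col-row-0 : Residues._-_ Z (colOf (Residues.[_] Z 0ℤ)) (rowOf (Residues.[_] Z 0ℤ)) ≡ η)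
  (col-row : ∀ δ → δ ≢ Residues.[_] Z 0ℤ → Residues._-_ Z (colOf δ) (rowOf δ) ≡ δ) where

  open Residues Z
  module K = Residues K

  Position : Set
  Position = Fin (ℕ.suc (ℕ.suc k))

  private
    𝟘 𝟙 : Position
    𝟘 = [ 0ℤ ]
    𝟙 = [ 1ℤ ]

  row⁻¹ col⁻¹ : Position → Position
  row⁻¹ x = proj₁ (row-surjective x)
  col⁻¹ x = proj₁ (col-surjective x)

  row-row⁻¹ : ∀ x → rowOf (row⁻¹ x) ≡ x
  row-row⁻¹ x = proj₂ (row-surjective x)

  col-col⁻¹ : ∀ x → colOf (col⁻¹ x) ≡ x
  col-col⁻¹ x = proj₂ (col-surjective x)

  row⁻¹-row : ∀ δ → row⁻¹ (rowOf δ) ≡ δ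
  row⁻¹-row = right-inverse⇒left-inverse rowOf row⁻¹ row-row⁻¹

  module Constant = SkipTwo 0≢η
  -- Block row x already uses the names of x and x + 1; block column y uses those of y + 1 and, as
  -- -η = η, of y + η. The borders run through the remaining offsets.
  module Right = SkipTwo 0≢1
  module Bottom = SkipTwo 1≢η

  Line : Set
  Line = Position ⊎ Fin k

  label : Position → Line
  label δ with δ ≟ 𝟘 | δ ≟ η
  ... | yes _ | _ = inj₁ δ
  ... | no _ | yes _ = inj₁ δ
  ... | no δ≢0 | no δ≢η = inj₂ (proj₁ (Constant.skip-surjective δ≢0 δ≢η))

  label-0 : label 𝟘 ≡ inj₁ 𝟘
  label-0 with 𝟘 ≟ 𝟘
  ... | yes _ = refl
  ... | no 0≢0 = ⊥-elim (0≢0 refl)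

  label-η : label η ≡ inj₁ η
  label-η with η ≟ 𝟘 | η ≟ η
  ... | yes _ | _ = refl
  ... | no _ | yes _ = refl
  ... | no _ | no η≢η = ⊥-elim (η≢η refl)

  label-skip : ∀ e → label (Constant.skip e) ≡ inj₂ e
  label-skip e with Constant.skip e ≟ 𝟘 | Constant.skip e ≟ η
  ... | yes eq | _ = ⊥-elim (Constant.skip≢ˡ e eq)
  ... | no _ | yes eq = ⊥-elim (Constant.skip≢ʳ e eq)
  ... | no ≢0 | no ≢η = cong inj₂ (Constant.skip-injective (proj₂ (Constant.skip-surjective ≢0 ≢η)))

  -- A bijection from ℤ/m to the symbols that are not constants. Indexing it by rows puts the
  -- symbols 0 and η on the diagonal cells 0 and η, both of difference η; the other elements name
  -- the new symbols.
  name : Position → Line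
  name x = label (row⁻¹ x)

  name-row : ∀ δ → name (rowOf δ) ≡ label δ
  name-row δ = cong label (row⁻¹-row δ)

  data Symbol : Line → Set where
    constant : ∀ {σ} → σ ≢ 𝟘 → σ ≢ η → Symbol (inj₁ σ)
    named : ∀ {z} x → name x ≡ z → Symbol z

  symbol : ∀ z → Symbol z
  symbol (inj₂ e) = named (rowOf (Constant.skip e)) (trans (name-row _) (label-skip e))
  symbol (inj₁ σ) with σ ≟ 𝟘 | σ ≟ η
  ... | yes refl | _ = named (rowOf 𝟘) (trans (name-row 𝟘) label-0)
  ... | no _ | yes refl = named (rowOf η) (trans (name-row η) label-η)
  ... | no σ≢0 | no σ≢η = constant σ≢0 σ≢η

  abstract
    inside : Position → Position → Line
    inside x d = if does (d ≟ η) then name x else if does (d ≟ 𝟘) then name (x + 𝟙) else inj₁ d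

    inside-η : ∀ {x d} → d ≡ η → inside x d ≡ name x
    inside-η {x} {d} d≡η = cong (λ b → if b then name x else if does (d ≟ 𝟘) then name (x + 𝟙) else inj₁ d)
      (dec-true (d ≟ η) d≡η)

    inside-≢η : ∀ {x d} → d ≢ η → inside x d ≡ (if does (d ≟ 𝟘) then name (x + 𝟙) else inj₁ d)
    inside-≢η {x} {d} d≢η = cong (λ b → if b then name x else if does (d ≟ 𝟘) then name (x + 𝟙) else inj₁ d)
      (dec-false (d ≟ η) d≢η)

    inside-0 : ∀ {x d} → d ≡ 𝟘 → inside x d ≡ name (x + 𝟙)
    inside-0 {x} {d} d≡0 = trans (inside-≢η (0≢η ∘ trans (sym d≡0)))
      (cong (λ b → if b then name (x + 𝟙) else inj₁ d) (dec-true (d ≟ 𝟘) d≡0))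

    inside-constant : ∀ {x d} → d ≢ 𝟘 → d ≢ η → inside x d ≡ inj₁ d
    inside-constant {x} {d} d≢0 d≢η = trans (inside-≢η d≢η)
      (cong (λ b → if b then name (x + 𝟙) else inj₁ d) (dec-false (d ≟ 𝟘) d≢0))

  entry : Line → Line → Line
  entry (inj₁ δ) (inj₁ ε) = inside (rowOf δ) (colOf ε - rowOf δ)
  entry (inj₁ δ) (inj₂ e) = name (rowOf δ + Right.skip e)
  entry (inj₂ e) (inj₁ ε) = name (colOf ε + Bottom.skip e)
  entry (inj₂ e) (inj₂ f) = inj₁ (Constant.skip (e K.+ f))

  rows : ∀ x z → ∃ λ y → entry x y ≡ z
  rows (inj₁ δ) z with symbol z
  ... | constant {σ} σ≢0 σ≢η = inj₁ (col⁻¹ (rowOf δ + σ)) ,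
    trans (cong (inside (rowOf δ)) (trans (cong (_- rowOf δ) (col-col⁻¹ _))
      (solve 2 (λ x σ → x :+ σ :- x := σ) refl (rowOf δ) σ)))
      (inside-constant σ≢0 σ≢η)
  -- Offset 0 belongs to the block cell of difference η, offset 1 to the cell of difference 0, and
  -- every other offset to the border.
  ... | named x refl with x - rowOf δ ≟ 𝟘 | x - rowOf δ ≟ 𝟙
  ...   | yes ≡0 | _ = inj₁ (col⁻¹ (rowOf δ + η)) ,
    trans (inside-η (trans (cong (_- rowOf δ) (col-col⁻¹ _))
      (solve 2 (λ x η → x :+ η :- x := η) refl (rowOf δ) η)))
      (cong name (difference ≡0))
    where
    difference : ∀ {x y} → x - y ≡ 𝟘 → y ≡ x
    difference {x} {y} eq = trans (solve 1 (λ y → y := con 0ℤ :+ y) refl y)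
      (trans (cong (_+ y) (sym eq)) (solve 2 (λ x y → x :- y :+ y := x) refl x y))
  ...   | no _ | yes ≡1 = inj₁ (col⁻¹ (rowOf δ)) ,
    trans (inside-0 (trans (cong (_- rowOf δ) (col-col⁻¹ _)) (solve 1 (λ x → x :- x := con 0ℤ) refl (rowOf δ))))
      (cong name (trans (cong (rowOf δ +_) (sym ≡1)) (solve 2 (λ x y → y :+ (x :- y) := x) refl x (rowOf δ))))
  ...   | no ≢0 | no ≢1 = let e , eq = Right.skip-surjective ≢0 ≢1 in inj₂ e ,
    cong name (trans (cong (rowOf δ +_) eq) (solve 2 (λ x y → y :+ (x :- y) := x) refl x (rowOf δ)))
  rows (inj₂ e) z with symbol z
  ... | constant σ≢0 σ≢η = let g , eq = Constant.skip-surjective σ≢0 σ≢η; f , eq′ , _ = proj₁ (+-isLatin K) e g in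
    inj₂ f , cong inj₁ (trans (cong Constant.skip eq′) eq)
  ... | named x refl = inj₁ (col⁻¹ (x - Bottom.skip e)) , cong name
    (trans (cong (_+ Bottom.skip e) (col-col⁻¹ _)) (solve 2 (λ x v → x :- v :+ v := x) refl x (Bottom.skip e)))

  cols : ∀ y z → ∃ λ x → entry x y ≡ z
  cols (inj₁ ε) z with symbol z
  ... | constant {σ} σ≢0 σ≢η = inj₁ (row⁻¹ (colOf ε - σ)) ,
    trans (cong (inside _) (trans (cong (λ x → colOf ε - x) (row-row⁻¹ _))
      (solve 2 (λ y σ → y :- (y :- σ) := σ) refl (colOf ε) σ)))
      (inside-constant σ≢0 σ≢η)
  ... | named x refl with x - colOf ε ≟ 𝟙 | x - colOf ε ≟ η
  ...   | yes ≡1 | _ = inj₁ (row⁻¹ (colOf ε)) ,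
    trans (inside-0 (trans (cong (λ x → colOf ε - x) (row-row⁻¹ _)) (solve 1 (λ x → x :- x := con 0ℤ) refl (colOf ε))))
      (cong name (trans (cong₂ _+_ (row-row⁻¹ (colOf ε)) (sym ≡1))
        (solve 2 (λ x y → y :+ (x :- y) := x) refl x (colOf ε))))
  ...   | no _ | yes ≡η = inj₁ (row⁻¹ x) ,
    trans (inside-η (trans (cong (λ x → colOf ε - x) (row-row⁻¹ x)) (begin
      colOf ε - x                          ≡⟨ solve 2 (λ x y → y :- x := con 0ℤ :- (x :- y)) refl x (colOf ε) ⟩
      𝟘 - (x - colOf ε)                    ≡⟨ cong₂ _-_ (sym η+η≡0) ≡η ⟩
      η + η - η                          ≡⟨ solve 1 (λ η → η :+ η :- η := η) refl η ⟩
      η                                  ∎)))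
      (cong name (row-row⁻¹ x))
    where open ≡-Reasoning
  ...   | no ≢1 | no ≢η = let e , eq = Bottom.skip-surjective ≢1 ≢η in inj₂ e ,
    cong name (trans (cong (colOf ε +_) eq) (solve 2 (λ x y → y :+ (x :- y) := x) refl x (colOf ε)))
  cols (inj₂ e) z with symbol z
  ... | constant σ≢0 σ≢η = let g , eq = Constant.skip-surjective σ≢0 σ≢η; f , eq′ , _ = proj₂ (+-isLatin K) e g in
    inj₂ f , cong inj₁ (trans (cong Constant.skip eq′) eq)
  ... | named x refl = inj₁ (row⁻¹ (x - Right.skip e)) , cong name
    (trans (cong (_+ Right.skip e) (row-row⁻¹ _)) (solve 2 (λ x v → x :- v :+ v := x) refl x (Right.skip e)))

  diagonal : ∀ δ → entry (inj₁ δ) (inj₁ δ) ≡ inj₁ δ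
  diagonal δ with δ ≟ 𝟘 | δ ≟ η
  ... | yes refl | _ = trans (inside-η col-row-0) (trans (name-row 𝟘) label-0)
  ... | no ≢0 | yes refl = trans (inside-η (col-row η ≢0)) (trans (name-row η) label-η)
  ... | no ≢0 | no ≢η = trans (cong (inside (rowOf δ)) (col-row δ ≢0)) (inside-constant ≢0 ≢η)

  -- The constants come first, as the symbols below k, followed by 0 and then η.
  index : Position → Fin (ℕ.suc (ℕ.suc k))
  index δ with δ ≟ 𝟘 | δ ≟ η
  ... | yes _ | _ = inject₁ (fromℕ k)
  ... | no _ | yes _ = fromℕ (ℕ.suc k)
  ... | no ≢0 | no ≢η = inject≤ (proj₁ (Constant.skip-surjective ≢0 ≢η)) (ℕₚ.m≤n+m k 2)

  position : Fin (ℕ.suc (ℕ.suc k)) → Position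
  position i with below k i | i ≟ fromℕ (ℕ.suc k)
  ... | just e | _ = Constant.skip e
  ... | nothing | no _ = 𝟘
  ... | nothing | yes _ = η

  position-index : ∀ δ → position (index δ) ≡ δ
  position-index δ with δ ≟ 𝟘 | δ ≟ η
  ... | yes refl | _ rewrite below-≥ k (inject₁ (fromℕ k)) (ℕₚ.≤-reflexive (sym (trans (toℕ-inject₁ (fromℕ k)) (toℕ-fromℕ k))))
      with inject₁ (fromℕ k) ≟ fromℕ (ℕ.suc k)
  ...   | no _ = refl
  ...   | yes eq = ⊥-elim (ℕₚ.1+n≢n (sym (trans (sym (trans (toℕ-inject₁ (fromℕ k)) (toℕ-fromℕ k)))
          (trans (cong toℕ eq) (toℕ-fromℕ (ℕ.suc k))))))
  position-index δ | no _ | yes refl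
      rewrite below-≥ k (fromℕ (ℕ.suc k)) (ℕₚ.≤-trans (ℕₚ.n≤1+n k) (ℕₚ.≤-reflexive (sym (toℕ-fromℕ (ℕ.suc k)))))
      with fromℕ (ℕ.suc k) ≟ fromℕ (ℕ.suc k)
  ...   | yes _ = refl
  ...   | no neq = ⊥-elim (neq refl)
  position-index δ | no ≢0 | no ≢η
      rewrite below-inject≤ (proj₁ (Constant.skip-surjective ≢0 ≢η)) (ℕₚ.m≤n+m k 2) =
        proj₂ (Constant.skip-surjective ≢0 ≢η)

  index-const : ∀ e → toℕ (index (Constant.skip e)) ≡ toℕ e
  index-const e with Constant.skip e ≟ 𝟘 | Constant.skip e ≟ η
  ... | yes eq | _ = ⊥-elim (Constant.skip≢ˡ e eq)
  ... | no _ | yes eq = ⊥-elim (Constant.skip≢ʳ e eq)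
  ... | no ≢0 | no ≢η = trans (toℕ-inject≤ _ (ℕₚ.m≤n+m k 2))
    (cong toℕ (Constant.skip-injective (proj₂ (Constant.skip-surjective ≢0 ≢η))))

  blueprint : Blueprint (ℕ.suc (ℕ.suc k)) K
  blueprint = record
    { Position = Position
    ; index = index
    ; position = position
    ; index-position = right-inverse⇒left-inverse position index position-index
    ; position-index = position-index
    ; entry = entry
    ; rows = rows
    ; cols = cols
    ; diagonal = diagonal
    ; const = Constant.skip
    ; index-const = index-const
    ; corner = λ _ _ → refl
    }

-- Rows and columns along the zigzag 0, -1, 1, -2, 2, … of ℤ/2h, whose
-- consecutive differences are -1, 2, -3, …; position 2v has column v and
-- position 2v + 1 has column h + v.
module Zigzag {q : ℕ} (Z : Residues q) (h : ℕ) (q≡2h : q ≡ h ℕ.+ h) (2≤h : 2 ≤ h) where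

  open Residues Z

  private
    ⟨_⟩ : ℕ → Fin q
    ⟨ n ⟩ = [ ℤ.+ n ]

    ⟨⟩-+ : ∀ a b → ⟨ a ℕ.+ b ⟩ ≡ ⟨ a ⟩ + ⟨ b ⟩
    ⟨⟩-+ a b = []-+ (ℤ.+ a) (ℤ.+ b)

    h<q : h < q
    h<q = subst (h <_) (sym q≡2h) (ℕₚ.m<m+n h (ℕₚ.<⇒≤ 2≤h))

    1<q : 1 < q
    1<q = ℕₚ.<-trans 2≤h h<q

    0<q : 0 < q
    0<q = ℕₚ.<⇒≤ 1<q

  η : Fin q
  η = ⟨ h ⟩

  η+η≡0 : η + η ≡ [ 0ℤ ]
  η+η≡0 = trans (sym (⟨⟩-+ h h)) (trans (cong ⟨_⟩ (sym q≡2h)) []-q)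

  0≢η : [ 0ℤ ] ≢ η
  0≢η eq = ℕₚ.<⇒≢ (ℕₚ.<⇒≤ 2≤h) ([]-injective 0<q h<q eq)

  0≢1 : [ 0ℤ ] ≢ [ 1ℤ ]
  0≢1 eq = ℕₚ.<⇒≢ ℕ.z<s ([]-injective 0<q 1<q eq)

  1≢η : [ 1ℤ ] ≢ η
  1≢η eq = ℕₚ.<⇒≢ 2≤h ([]-injective 1<q h<q eq)

  interleave : ℕ → ℕ
  interleave 0 = 0
  interleave 1 = h
  interleave (ℕ.suc (ℕ.suc n)) = ℕ.suc (interleave n)

  interleave-even : ∀ v → interleave (v ℕ.+ v) ≡ v
  interleave-even 0 = refl
  interleave-even (ℕ.suc v) rewrite ℕₚ.+-suc v v = cong ℕ.suc (interleave-even v)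

  interleave-odd : ∀ v → interleave (ℕ.suc (v ℕ.+ v)) ≡ h ℕ.+ v
  interleave-odd 0 = sym (ℕₚ.+-identityʳ h)
  interleave-odd (ℕ.suc v) rewrite ℕₚ.+-suc v v | ℕₚ.+-suc h v = cong ℕ.suc (interleave-odd v)

  -- No transversal takes every difference once, since a cyclic group of even order has no complete
  -- mapping. The rule `colOf δ - δ` at δ = 0 would repeat row 0 and omit row η; position 0
  -- therefore takes row η, and its difference becomes -η = η.
  rowOf colOf : Fin q → Fin q
  colOf δ = ⟨ interleave (toℕ δ) ⟩
  rowOf δ with δ ≟ [ 0ℤ ]
  ... | yes _ = η
  ... | no _ = colOf δ - δ

  row-0 : rowOf [ 0ℤ ] ≡ η
  row-0 with [ 0ℤ ] ≟ [ 0ℤ ]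
  ... | yes _ = refl
  ... | no 0≢0 = ⊥-elim (0≢0 refl)

  row-≢0 : ∀ {δ} → δ ≢ [ 0ℤ ] → rowOf δ ≡ colOf δ - δ
  row-≢0 {δ} δ≢0 with δ ≟ [ 0ℤ ]
  ... | yes δ≡0 = ⊥-elim (δ≢0 δ≡0)
  ... | no _ = refl

  col-⟨⟩ : ∀ {n} → n < q → colOf ⟨ n ⟩ ≡ ⟨ interleave n ⟩
  col-⟨⟩ n<q = cong (λ n → ⟨ interleave n ⟩) (toℕ-[] n<q)

  col-row-0 : colOf [ 0ℤ ] - rowOf [ 0ℤ ] ≡ η
  col-row-0 = begin
    colOf [ 0ℤ ] - rowOf [ 0ℤ ]   ≡⟨ cong₂ _-_ (col-⟨⟩ 0<q) row-0 ⟩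
    [ 0ℤ ] - η                ≡⟨ cong (_- η) (sym η+η≡0) ⟩
    η + η - η                 ≡⟨ solve 1 (λ η → η :+ η :- η := η) refl η ⟩
    η                         ∎
    where open ≡-Reasoning

  col-row : ∀ δ → δ ≢ [ 0ℤ ] → colOf δ - rowOf δ ≡ δ
  col-row δ δ≢0 = trans (cong (λ x → colOf δ - x) (row-≢0 δ≢0))
    (solve 2 (λ c δ → c :- (c :- δ) := δ) refl (colOf δ) δ)

  private
    double<q : ∀ {v} → v < h → v ℕ.+ v < q
    double<q v<h = subst (_ <_) (sym q≡2h) (ℕₚ.+-mono-< v<h v<h)

    1+double<q : ∀ {v} → v < h → ℕ.suc (v ℕ.+ v) < q
    1+double<q {v} v<h = subst (ℕ.suc (v ℕ.+ v) <_) (sym q≡2h)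
      (ℕₚ.≤-trans (ℕₚ.≤-reflexive (cong ℕ.suc (sym (ℕₚ.+-suc v v)))) (ℕₚ.+-mono-≤ v<h v<h))

  col-surjective : ∀ y → ∃ λ δ → colOf δ ≡ y
  col-surjective y with toℕ y ℕ.<? h
  ... | yes y<h = ⟨ toℕ y ℕ.+ toℕ y ⟩ ,
    trans (col-⟨⟩ (double<q y<h)) (trans (cong ⟨_⟩ (interleave-even (toℕ y))) ([]-toℕ y))
  ... | no y≮h = ⟨ ℕ.suc (w ℕ.+ w) ⟩ ,
    trans (col-⟨⟩ (1+double<q w<h)) (trans (cong ⟨_⟩ (trans (interleave-odd w) h+w≡y)) ([]-toℕ y))
    where
    w = toℕ y ∸ h
    h+w≡y = ℕₚ.m+[n∸m]≡n (ℕₚ.≮⇒≥ y≮h)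

    w<h : w < h
    w<h = ℕₚ.+-cancelˡ-< h w h (subst (_< h ℕ.+ h) (sym h+w≡y) (subst (toℕ y <_) q≡2h (toℕ<n y)))

  row-surjective : ∀ x → ∃ λ δ → rowOf δ ≡ x
  row-surjective x with ℕₚ.<-cmp (toℕ x) h
  -- Position 0 lies in row h, position 2v + 1 in row h - 1 - v, and position 2v with v > 0 in row
  -- -v = q - v.
  ... | tri≈ _ x≡h _ = [ 0ℤ ] , trans row-0 (trans (cong ⟨_⟩ (sym x≡h)) ([]-toℕ x))
  ... | tri< x<h _ _ = ⟨ ℕ.suc (v ℕ.+ v) ⟩ , (begin
      rowOf ⟨ ℕ.suc (v ℕ.+ v) ⟩
        ≡⟨ row-≢0 (λ eq → ℕₚ.1+n≢0 ([]-injective (1+double<q v<h) 0<q eq)) ⟩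
      colOf ⟨ ℕ.suc (v ℕ.+ v) ⟩ - ⟨ ℕ.suc (v ℕ.+ v) ⟩
        ≡⟨ cong₂ _-_ (trans (col-⟨⟩ (1+double<q v<h)) (cong ⟨_⟩ (interleave-odd v)))
             (trans (⟨⟩-+ 1 (v ℕ.+ v)) (cong ([ 1ℤ ] +_) (⟨⟩-+ v v))) ⟩
      ⟨ h ℕ.+ v ⟩ - ([ 1ℤ ] + (⟨ v ⟩ + ⟨ v ⟩))
        ≡⟨ cong (_- ([ 1ℤ ] + (⟨ v ⟩ + ⟨ v ⟩))) (trans (cong (λ h → ⟨ h ℕ.+ v ⟩) (sym 1+x+v≡h))
             (trans (⟨⟩-+ (ℕ.suc (toℕ x) ℕ.+ v) v) (cong (_+ ⟨ v ⟩)
               (trans (⟨⟩-+ (ℕ.suc (toℕ x)) v) (cong (_+ ⟨ v ⟩) (⟨⟩-+ 1 (toℕ x))))))) ⟩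
      [ 1ℤ ] + ⟨ toℕ x ⟩ + ⟨ v ⟩ + ⟨ v ⟩ - ([ 1ℤ ] + (⟨ v ⟩ + ⟨ v ⟩))
        ≡⟨ solve 2 (λ x v → con 1ℤ :+ x :+ v :+ v :- (con 1ℤ :+ (v :+ v)) := x) refl ⟨ toℕ x ⟩ ⟨ v ⟩ ⟩
      ⟨ toℕ x ⟩
        ≡⟨ []-toℕ x ⟩
      x ∎)
    where
    open ≡-Reasoning
    v = h ∸ ℕ.suc (toℕ x)
    1+x+v≡h = ℕₚ.m+[n∸m]≡n x<h

    v<h : v < h
    v<h = subst (v <_) 1+x+v≡h (ℕₚ.m<n+m v ℕ.z<s)
  ... | tri> _ _ h<x = ⟨ v ℕ.+ v ⟩ , (begin
      rowOf ⟨ v ℕ.+ v ⟩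
        ≡⟨ row-≢0 (λ eq → ℕₚ.<⇒≢ (ℕₚ.<-≤-trans 0<v (ℕₚ.m≤m+n v v)) (sym ([]-injective (double<q v<h) 0<q eq))) ⟩
      colOf ⟨ v ℕ.+ v ⟩ - ⟨ v ℕ.+ v ⟩
        ≡⟨ cong₂ _-_ (trans (col-⟨⟩ (double<q v<h)) (cong ⟨_⟩ (interleave-even v))) (⟨⟩-+ v v) ⟩
      ⟨ v ⟩ - (⟨ v ⟩ + ⟨ v ⟩)
        ≡⟨ solve 1 (λ v → v :- (v :+ v) := :- v) refl ⟨ v ⟩ ⟩
      neg ⟨ v ⟩
        ≡⟨ neg-[] v x x+v≡q ⟩
      x ∎)
    where
    open ≡-Reasoning
    v = q ∸ toℕ x
    x+v≡q = ℕₚ.m+[n∸m]≡n (ℕₚ.<⇒≤ (toℕ<n x))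

    0<v : 0 < v
    0<v = ℕₚ.m<n⇒0<n∸m (toℕ<n x)

    v<h : v < h
    v<h = ℕₚ.+-cancelˡ-< h v h (subst (h ℕ.+ v <_) (trans x+v≡q q≡2h) (ℕₚ.+-monoˡ-< v h<x))

-- Choice of the construction by the parity of m and the size of k

data Parity : ℕ → Set where
  even : ∀ h → Parity (h ℕ.+ h)
  odd : ∀ h → Parity (ℕ.suc (h ℕ.+ h))

parity : ∀ n → Parity n
parity 0 = even 0
parity (ℕ.suc n) with parity n
... | even h = odd h
... | odd h = subst Parity (cong ℕ.suc (ℕₚ.+-suc h h)) (even (ℕ.suc h))

-- The representative of -1 is one less than the modulus, hence positive.
neg-1≢0 : ∀ {q} (Z : Residues (ℕ.suc (ℕ.suc q))) → let open Residues Z in neg [ 1ℤ ] ≢ [ 0ℤ ]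
neg-1≢0 {q} Z eq = ℕₚ.1+n≢0 (trans (ℕₚ.+-cancelʳ-≡ 1 (ℕ.suc q) (toℕ x) (trans (ℕₚ.+-comm _ 1) (sym x+1≡q)))
  (trans (cong toℕ (trans (sym (neg-[] 1 x x+1≡q)) eq)) (toℕ-[] ℕ.z<s)))
  where
  open Residues Z
  x = proj₁ (greatest [ 0ℤ ])
  x+1≡q = proj₂ (greatest [ 0ℤ ])

oddBlueprint : ∀ h {k} (K : Residues k) → k ≤ ℕ.suc (h ℕ.+ h) → Blueprint (ℕ.suc (h ℕ.+ h)) K
oddBlueprint h K k≤m = OddCase.blueprint Z K k≤m half half-double
  where
  Z = residues (ℕ.suc (h ℕ.+ h))
  open Residues.Halving Z h refl

-- Here m = q + 1 = 2 (g + 2), so q is odd and at least 3; k is compared with m, m - 1 and m - 2.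
evenBlueprint : ∀ g {k} (K : Residues k) → 1 ≤ k → let q = ℕ.suc (ℕ.suc g ℕ.+ ℕ.suc g) in
  k ≤ ℕ.suc q → Blueprint (ℕ.suc q) K
evenBlueprint g {k} K 1≤k k≤1+q with k ℕ.≟ ℕ.suc q′ | k ℕ.≟ q′ | k ℕ.≟ ℕ.pred q′
  where q′ = ℕ.suc (ℕ.suc g ℕ.+ ℕ.suc g)
... | yes refl | _ | _ = EvenCase-k≡m.blueprint Z K half half-double (neg [ 1ℤ ]) (neg-1≢0 Z)
  where
  Z = residues (ℕ.suc (ℕ.suc g ℕ.+ ℕ.suc g))
  open Residues Z
  open Halving (ℕ.suc g) refl
-- As k = q, the ring `K` of the corner also serves for the finite points.
... | no _ | yes refl | _ = EvenCase-k≡m∸1.blueprint K half half-double (neg [ 1ℤ ]) (neg-1≢0 K)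
  where
  open Residues K
  open Halving (ℕ.suc g) refl
... | no _ | no _ | yes refl = EvenCase-k≡m∸2.blueprint Z K η η+η≡0 0≢η 0≢1 1≢η rowOf colOf
    row-surjective col-surjective col-row-0 col-row
  where
  Z = residues (ℕ.suc (ℕ.suc (ℕ.suc g ℕ.+ ℕ.suc g)))
  open Zigzag Z (ℕ.suc (ℕ.suc g)) (cong ℕ.suc (sym (ℕₚ.+-suc (ℕ.suc g) (ℕ.suc g)))) (s≤s (s≤s z≤n))
evenBlueprint g {ℕ.suc k} K 1≤k k≤1+q | no k≢1+q | no k≢q | no k≢q-1 =
  EvenCase-k≤m∸3.blueprint Z K k+3≤q half half-double (neg-1≢0 Z)
  where
  Z = residues (ℕ.suc (ℕ.suc g ℕ.+ ℕ.suc g))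
  open Residues Z
  open Halving (ℕ.suc g) refl

  k+3≤q : k ℕ.+ 3 ≤ ℕ.suc (ℕ.suc g ℕ.+ ℕ.suc g)
  -- Each excluded value lowers the bound by one, from `suc k` ≤ q + 1 down to `suc k` ≤ q - 2.
  k+3≤q = subst (_≤ ℕ.suc (ℕ.suc g ℕ.+ ℕ.suc g)) (ℕₚ.+-comm 3 k)
    (s≤s (ℕₚ.≤∧≢⇒< (ℕₚ.≤-pred (ℕₚ.≤∧≢⇒< (ℕₚ.≤-pred (ℕₚ.≤∧≢⇒< k≤1+q k≢1+q)) k≢q)) k≢q-1))

blueprint : ∀ m k (K : Residues k) → 1 ≤ k → k ≤ m → 5 ≤ m ℕ.+ k → Blueprint m K
blueprint m k K 1≤k k≤m 5≤m+k with parity m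
... | odd h = oddBlueprint h K k≤m
... | even 0 = ⊥-elim (ℕₚ.<⇒≱ 1≤k k≤m)
-- For m = 2 the order would be at most 4; this is where n ≥ 5 enters.
... | even 1 = ⊥-elim (ℕₚ.<⇒≱ 5≤m+k (ℕₚ.+-monoʳ-≤ 2 k≤m))
... | even (ℕ.suc (ℕ.suc g)) = subst (λ m → Blueprint m K) (cong ℕ.suc (sym (ℕₚ.+-suc (ℕ.suc g) (ℕ.suc g))))
  (evenBlueprint g K 1≤k (subst (k ≤_) (cong ℕ.suc (ℕₚ.+-suc (ℕ.suc g) (ℕ.suc g))) k≤m))

open import Data.Nat using (_*_)

theorem3p9 : (n k : ℕ) → 5 ≤ n → 1 ≤ k → (n2k : 2 * k ≤ n) →
    Σ (Square n) λ L →
    IsLatin L ×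
    ((i : Fin n) → toℕ i < n ∸ k → L i i ≡ i) ×
    (Σ (Square k) λ S →
    IsLatin S ×
    ((a b : Fin k) →
    toℕ (L (lastBlock (≤-trans (m≤n*m k 2) n2k) a) (lastBlock (≤-trans (m≤n*m k 2) n2k) b))
    ≡ toℕ (S a b))) ×
    (Σ (List (Cell n)) λ T → IsMaximalPartialTransversal L T × length T ≡ n ∸ k)
theorem3p9 n k@(ℕ.suc _) 5≤n 1≤k n2k = realise k≤n n≡m+k
    (blueprint (n ∸ k) k (residues k) 1≤k k≤m (subst (5 ≤_) n≡m+k 5≤n))
  where
  k≤n = ≤-trans (m≤n*m k 2) n2k
  n≡m+k = sym (ℕₚ.m∸n+n≡m k≤n)

  k≤m : k ≤ n ∸ k
  k≤m = ℕₚ.m+n≤o⇒m≤o∸n k (subst (_≤ n) (cong (k ℕ.+_) (ℕₚ.+-identityʳ k)) n2k)
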